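{- Let $n\ge1$. The restriction of $\Psi$ to $\mathfrak{S}_n(213)$ is a bijection from $\mathfrak{S}_n(213)$ onto $\mathfrak{S}_n(321)$.
   Context: $\mathfrak{S}_n(\tau)$ is the set of permutations of $[n]$ avoiding the classical pattern $\tau$. The map $\Phi:\mathfrak{S}_m\to\mathfrak{S}_m$: for $\rho\in\mathfrak{S}_m$, a letter $\rho(i)$ is a descent top if $i\le m-1$ and $\rho(i)>\rho(i+1)$, a descent bottom if $i\ge2$ and $\rho(i-1)>\rho(i)$; otherwise a nondescent top (resp. bottom). For $x=\rho(i)$ let $c(x)=\#\{j:i<j<m,\ \rho(j+1)<x<\rho(j)\}$. Let $f$ (resp. $g$) be the increasing word of descent bottoms (resp. nondescent bottoms); $f'$ the arrangement of descent tops in which each letter $x$ has exactly $c(x)$ larger letters to its left; $g'$ the arrangement of nondescent tops in which each letter $x$ has exactly $c(x)$ smaller letters to its right. With the two-row array of top row $fg$ and bottom row $f'g'$, $\Phi(\rho)=\tau$ with $\tau(b)=a$ for each column (top $a$, bottom $b$). The map $\Psi:\mathfrak{S}_n\to\mathfrak{S}_n$: for $\sigma\in\mathfrak{S}_n$ let $\hat\sigma\in\mathfrak{S}_{n+1}$, $\hat\sigma(i)=\sigma(i)+1$ for $i\le n$, $\hat\sigma(n+1)=1$; $\tau=\Phi(\hat\sigma)$ has $\tau(1)=n+1$, and $\Psi(\sigma)=\tau(2)\cdots\tau(n+1)$. -}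

module Defs where

open import Data.Fin.Base using (Fin; zero; suc; toℕ; fromℕ; inject₁; cast; punchIn; _<_)
open import Data.Fin.Patterns using (0F; 1F)
open import Data.Fin.Permutation
  using (Permutation; Permutation′; _⟨$⟩ʳ_; _⟨$⟩ˡ_; _≈_; _∘ₚ_; flip; cast-id;
         insert; remove; transpose; reverse; inverseˡ; inverseʳ;
         insert-punchIn; punchIn-permute)
open import Data.Fin.Properties
  using (_<?_; ≤fromℕ; any?; _≟_; <-cmp; <-asym; <-irrefl; toℕ-injective;
         inject₁-injective;
         toℕ-cast; cast-involutive)
open import Data.List.Base as List
  using (List; []; _∷_; _++_; _∷ʳ_; length; filter; allFin; map; tabulate; lookup)
open import Data.List.Membership.Propositional using (_∈_; lose)
open import Data.List.Membership.Propositional.Properties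
  using (∈-∃++; ∈-filter⁺; ∈-filter⁻; ∈-allFin; ∈-map⁺; ∈-++⁺ʳ)
open import Data.List.Membership.Propositional.Properties.WithK using (unique∧set⇒bag)
open import Data.List.Properties
  using (filter-accept; filter-reject; filter-all; filter-++; filter-some; filter-none; filter-≐;
         length-take; take++drop≡id; ++-assoc; ∷-injective; ∷ʳ-injectiveʳ;
         length-tabulate; lookup-tabulate; map-tabulate; map-++;
         unfold-reverse; reverse-++; reverse-involutive; reverse-injective)
open import Data.List.Relation.Binary.BagAndSetEquality using (∼bag⇒↭)
open import Data.List.Relation.Binary.Permutation.Propositional
  using (_↭_; ↭-refl; ↭-sym; ↭-trans; ↭-prep; ↭⇒↭ₛ; ↭-reflexive)
open import Data.List.Relation.Binary.Permutation.Propositional.Properties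
  using (∈-resp-↭; All-resp-↭; ↭-length; ↭-reverse; filter-↭; drop-mid; shift; ++⁺; ↭-empty-inv)
open import Data.List.Relation.Binary.Permutation.Setoid using (onIndices)
open import Data.List.Relation.Binary.Permutation.Setoid.Properties using (onIndices-lookup)
open import Data.List.Relation.Binary.Pointwise as Pointwise using (Pointwise; []; _∷_)
open import Data.List.Relation.Unary.All as All using (All; []; _∷_)
open import Data.List.Relation.Unary.AllPairs as AllPairs using (AllPairs; []; _∷_)
import Data.List.Relation.Unary.All.Properties as All
import Data.List.Relation.Unary.AllPairs.Properties as AllPairs
import Data.List.Relation.Unary.Unique.Propositional.Properties as Unique
open import Data.List.Relation.Unary.Any using (here; there)
open import Data.Nat.Base as ℕ using (ℕ; zero; suc; z≤n; s≤s)
import Data.Nat.Properties as ℕ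
open import Data.Product.Base using (Σ; Σ-syntax; ∃; ∃-syntax; _×_; _,_; proj₁; proj₂)
open import Data.Sum.Base using (_⊎_; inj₁; inj₂)
open import Data.Unit.Base using (tt)
open import Function.Base using (_∘_; id)
open import Function.Bundles using (_⇔_; mk⇔; Injection)
open import Function.Properties.Inverse using (↔⇒↣)
open import Level using (0ℓ)
open import Relation.Binary.Core using (Rel)
open import Relation.Binary.Definitions using (Asymmetric; tri<; tri≈; tri>)
import Relation.Binary.Definitions as Binary
open import Relation.Binary.PropositionalEquality
  using (_≡_; _≢_; refl; sym; trans; cong; cong₂; subst; setoid; module ≡-Reasoning)
open import Relation.Nullary using (¬_; Dec; yes; no; ¬?; contradiction)
open import Relation.Nullary.Decidable using (_×-dec_)
open import Relation.Unary using (Pred; Decidable; _≐_)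

private
  variable
    m n k : ℕ
    A : Set

-- Positions and letters in [m] are represented by Fin m, so both are shifted
-- down by one.  A permutation ρ is the word ρ(1) ⋯ ρ(m) with ρ(i) = ρ ⟨$⟩ʳ i, and
-- the position of the letter x is ρ ⟨$⟩ˡ x.

_Contains_ : Permutation′ n → Permutation′ k → Set
_Contains_ {n} {k} σ π =
  Σ[ p ∈ (Fin k → Fin n) ]
    (∀ {a b} → a < b → p a < p b) ×
    (∀ a b → (σ ⟨$⟩ʳ p a) < (σ ⟨$⟩ʳ p b) ⇔ (π ⟨$⟩ʳ a) < (π ⟨$⟩ʳ b))

_Avoids_ : Permutation′ n → Permutation′ k → Set
σ Avoids π = ¬ (σ Contains π)

[213] [321] : Permutation′ 3
[213] = transpose 0F 1F
[321] = reverse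

𝔖 : ∀ n → Permutation′ k → Set
𝔖 n π = Σ[ σ ∈ Permutation′ n ] σ Avoids π

#_ : {P : Pred (Fin m) 0ℓ} → Decidable P → ℕ
# P? = length (filter P? (allFin _))

Consecutive : Rel (Fin m) 0ℓ
Consecutive i j = toℕ j ≡ suc (toℕ i)

module _ (ρ : Permutation′ m) where

  DescentTop DescentBottom : Pred (Fin m) 0ℓ
  DescentTop    x = ∃[ j ] Consecutive (ρ ⟨$⟩ˡ x) j × (ρ ⟨$⟩ʳ j) < x
  DescentBottom x = ∃[ i ] Consecutive i (ρ ⟨$⟩ˡ x) × x < (ρ ⟨$⟩ʳ i)

  descentTop? : Decidable DescentTop
  descentTop? x = any? λ j → (toℕ j ℕ.≟ _) ×-dec (_ <? x)

  descentBottom? : Decidable DescentBottom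
  descentBottom? x = any? λ i → (_ ℕ.≟ suc (toℕ i)) ×-dec (x <? _)

  -- The increasing words on these sets of letters.
  descentTops nondescentTops descentBottoms nondescentBottoms : List (Fin m)
  descentTops       = filter descentTop? (allFin m)
  nondescentTops    = filter (¬? ∘ descentTop?) (allFin m)
  descentBottoms    = filter descentBottom? (allFin m)
  nondescentBottoms = filter (¬? ∘ descentBottom?) (allFin m)

  CrossedAt : Fin m → Pred (Fin m) 0ℓ
  CrossedAt x j = ∃[ j′ ] Consecutive j j′ × (ρ ⟨$⟩ʳ j′) < x × x < (ρ ⟨$⟩ʳ j)

  crossedAt? : ∀ x → Decidable (CrossedAt x)
  crossedAt? x j = any? λ j′ → (toℕ j′ ℕ.≟ _) ×-dec ((_ <? x) ×-dec (x <? _))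

  crossings : Fin m → ℕ
  crossings x = # λ j → ((ρ ⟨$⟩ˡ x) <? j) ×-dec crossedAt? x j

-- Each letter x of the word has exactly c x larger letters to its left,
-- respectively smaller letters to its right.
LargerToLeft SmallerToRight : (Fin m → ℕ) → List (Fin m) → Set
LargerToLeft   c w = ∀ ys x zs → w ≡ ys ++ x ∷ zs → length (filter (x <?_) ys) ≡ c x
SmallerToRight c w = ∀ ys x zs → w ≡ ys ++ x ∷ zs → length (filter (_<? x) zs) ≡ c x

-- The graph of Φ.  The top row of the array is descentBottoms ρ followed by
-- nondescentBottoms ρ, and its bottom row is f′ followed by g′.
record IsΦ (ρ τ : Permutation′ m) : Set where
  field
    f′ g′      : List (Fin m)
    f′-letters : f′ ↭ descentTops ρ
    f′-code    : LargerToLeft (crossings ρ) f′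
    g′-letters : g′ ↭ nondescentTops ρ
    g′-code    : SmallerToRight (crossings ρ) g′
    columns    : Pointwise (λ a b → τ ⟨$⟩ʳ b ≡ a)
                   (descentBottoms ρ ++ nondescentBottoms ρ) (f′ ++ g′)

-- Arrangements with prescribed numbers of ≻-letters to the left of each letter.
private
  module Arrangement {A : Set} {_≺_ : Rel A 0ℓ} (_≺?_ : Binary.Decidable _≺_)
                     (asym : Asymmetric _≺_) (c : A → ℕ) where

    above : A → List A → ℕ
    above x ys = length (filter (x ≺?_) ys)

    Coded : List A → Set
    Coded w = ∀ ys x zs → w ≡ ys ++ x ∷ zs → above x ys ≡ c x

    split-∷ : ∀ (as : List A) {bs x} ys {y zs} → as ++ x ∷ bs ≡ ys ++ y ∷ zs →
              (as ≡ ys × x ≡ y × bs ≡ zs)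
            ⊎ (∃[ ms ] as ≡ ys ++ y ∷ ms)
            ⊎ (∃[ ms ] ys ≡ as ++ x ∷ ms × bs ≡ ms ++ y ∷ zs)
    split-∷ [] [] refl = inj₁ (refl , refl , refl)
    split-∷ [] (y ∷ ys) refl = inj₂ (inj₂ (ys , refl , refl))
    split-∷ (a ∷ as) [] refl = inj₂ (inj₁ (as , refl))
    split-∷ (a ∷ as) (y ∷ ys) eq with ∷-injective eq
    ... | refl , eq′ with split-∷ as ys eq′
    ...   | inj₁ (refl , refl , refl) = inj₁ (refl , refl , refl)
    ...   | inj₂ (inj₁ (ms , refl)) = inj₂ (inj₁ (ms , refl))
    ...   | inj₂ (inj₂ (ms , refl , refl)) = inj₂ (inj₂ (ms , refl , refl))

    split-++ : ∀ (as : List A) {bs} ys {y zs} → as ++ bs ≡ ys ++ y ∷ zs →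
               (∃[ ms ] as ≡ ys ++ y ∷ ms)
             ⊎ (∃[ ms ] ys ≡ as ++ ms × bs ≡ ms ++ y ∷ zs)
    split-++ [] ys eq = inj₂ (ys , refl , eq)
    split-++ (a ∷ as) [] refl = inj₁ (as , refl)
    split-++ (a ∷ as) (y ∷ ys) eq with ∷-injective eq
    ... | refl , eq′ with split-++ as ys eq′
    ...   | inj₁ (ms , refl) = inj₁ (ms , refl)
    ...   | inj₂ (ms , refl , eq″) = inj₂ (ms , refl , eq″)

    above-skip : ∀ {x y} as bs → ¬ (y ≺ x) → above y (as ++ x ∷ bs) ≡ above y (as ++ bs)
    above-skip {x} {y} as bs y⊀x = cong length (begin
      filter (y ≺?_) (as ++ x ∷ bs)                ≡⟨ filter-++ (y ≺?_) as (x ∷ bs) ⟩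
      filter (y ≺?_) as ++ filter (y ≺?_) (x ∷ bs) ≡⟨ cong (filter (y ≺?_) as ++_) (filter-reject (y ≺?_) y⊀x) ⟩
      filter (y ≺?_) as ++ filter (y ≺?_) bs       ≡⟨ filter-++ (y ≺?_) as bs ⟨
      filter (y ≺?_) (as ++ bs)                    ∎)
      where open ≡-Reasoning

    private
      mid∈ : ∀ (ys : List A) {y zs} → y ∈ ys ++ y ∷ zs
      mid∈ ys = ∈-++⁺ʳ ys (here refl)

      insert-coded : ∀ {x} as bs → All (x ≺_) (as ++ bs) → length as ≡ c x →
                     Coded (as ++ bs) → Coded (as ++ x ∷ bs)
      insert-coded {x} as bs x≺ len code ys y zs eq with split-∷ as ys eq
      ... | inj₁ (refl , refl , refl) =
        trans (cong length (filter-all (x ≺?_) (All.++⁻ˡ as x≺))) len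
      ... | inj₂ (inj₁ (ms , refl)) = code ys y (ms ++ bs) (++-assoc ys (y ∷ ms) bs)
      ... | inj₂ (inj₂ (ms , refl , refl)) =
        trans (above-skip as ms (asym (All.lookup (All.++⁻ʳ as x≺) (mid∈ ms))))
              (code (as ++ ms) y zs (sym (++-assoc as ms (y ∷ zs))))

      delete-coded : ∀ {x} as bs → All (x ≺_) (as ++ bs) →
                     Coded (as ++ x ∷ bs) → length as ≡ c x × Coded (as ++ bs)
      delete-coded {x} as bs x≺ code =
        trans (sym (cong length (filter-all (x ≺?_) (All.++⁻ˡ as x≺)))) (code as x bs refl) , code′
        where
        code′ : Coded (as ++ bs)
        code′ ys y zs eq with split-++ as ys eq
        ... | inj₁ (ms , refl) = code ys y (ms ++ x ∷ bs) (++-assoc ys (y ∷ ms) (x ∷ bs))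
        ... | inj₂ (ms , refl , refl) =
          trans (sym (above-skip as ms (asym (All.lookup (All.++⁻ʳ as x≺) (mid∈ ms)))))
                (code (as ++ x ∷ ms) y zs (sym (++-assoc as (x ∷ ms) (y ∷ zs))))

      ++-injective : ∀ (as as′ : List A) {bs bs′} → length as ≡ length as′ →
                     as ++ bs ≡ as′ ++ bs′ → as ≡ as′ × bs ≡ bs′
      ++-injective [] [] _ eq = refl , eq
      ++-injective (a ∷ as) (a′ ∷ as′) len eq with ∷-injective eq
      ... | refl , eq′ with ++-injective as as′ (ℕ.suc-injective len) eq′
      ...   | refl , eq″ = refl , eq″

    arrange : ∀ {L} → AllPairs _≺_ L → (∀ {x} → x ∈ L → c x ℕ.≤ above x L) →
              ∃[ w ] w ↭ L × Coded w
    arrange [] _ = [] , ↭-refl , λ { [] _ _ () ; (_ ∷ _) _ _ () }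
    arrange {x ∷ L} (x≺ ∷ L≺) bound =
      let w , w↭L , code = arrange L≺ bound′
          as = List.take (c x) w
          bs = List.drop (c x) w
          as++bs≡w = take++drop≡id (c x) w
          cx≤ : c x ℕ.≤ length w
          cx≤ = subst (c x ℕ.≤_) (sym (↭-length w↭L)) cx≤L
      in as ++ x ∷ bs
       , ↭-trans (shift x as bs) (↭-prep x (↭-trans (↭-reflexive as++bs≡w) w↭L))
       , insert-coded as bs
           (subst (All (x ≺_)) (sym as++bs≡w) (All-resp-↭ (↭-sym w↭L) x≺))
           (trans (length-take (c x) w) (ℕ.m≤n⇒m⊓n≡m cx≤))
           (subst Coded (sym as++bs≡w) code)
      where
      bound′ : ∀ {y} → y ∈ L → c y ℕ.≤ above y L
      bound′ {y} y∈ = subst (c y ℕ.≤_)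
        (above-skip [] L (asym (All.lookup x≺ y∈))) (bound (there y∈))
      cx≤L : c x ℕ.≤ length L
      cx≤L = subst (c x ℕ.≤_)
        (cong length (trans (filter-reject (x ≺?_) (λ x≺x → asym x≺x x≺x)) (filter-all (x ≺?_) x≺)))
        (bound (here refl))

    arrange-unique : ∀ {L w w′} → AllPairs _≺_ L → w ↭ L → w′ ↭ L →
                     Coded w → Coded w′ → w ≡ w′
    arrange-unique [] w↭ w′↭ _ _ = trans (↭-empty-inv w↭) (sym (↭-empty-inv w′↭))
    arrange-unique {x ∷ L} (x≺ ∷ L≺) w↭ w′↭ code code′
      with ∈-∃++ (∈-resp-↭ (↭-sym w↭) (here refl)) | ∈-∃++ (∈-resp-↭ (↭-sym w′↭) (here refl))
    ... | as , bs , refl | as′ , bs′ , refl =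
      let L↭  = drop-mid as [] w↭
          L↭′ = drop-mid as′ [] w′↭
          len  , code₁ = delete-coded as bs (All-resp-↭ (↭-sym L↭) x≺) code
          len′ , code₂ = delete-coded as′ bs′ (All-resp-↭ (↭-sym L↭′) x≺) code′
          eq = arrange-unique L≺ L↭ L↭′ code₁ code₂
          as≡ , bs≡ = ++-injective as as′ (trans len (sym len′)) eq
      in cong₂ (λ us vs → us ++ x ∷ vs) as≡ bs≡

  length-filter-map : ∀ {B : Set} {P : Pred B 0ℓ} (P? : Decidable P) (f : A → B) xs →
                      length (filter P? (map f xs)) ≡ length (filter (P? ∘ f) xs)
  length-filter-map P? f [] = refl
  length-filter-map P? f (x ∷ xs) with P? (f x)
  ... | yes _ = cong suc (length-filter-map P? f xs)
  ... | no  _ = length-filter-map P? f xs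

  #-suc : {P : Pred (Fin (suc m)) 0ℓ} (P? : Decidable P) →
          length (filter P? (tabulate suc)) ≡ # (P? ∘ suc)
  #-suc P? = trans (cong (length ∘ filter P?) (sym (map-tabulate id suc)))
                   (length-filter-map P? suc (allFin _))

  #-zero-yes : {P : Pred (Fin (suc m)) 0ℓ} (P? : Decidable P) → P zero →
               # P? ≡ suc (# (P? ∘ suc))
  #-zero-yes P? p = trans (cong length (filter-accept P? p)) (cong suc (#-suc P?))

  #-zero-no : {P : Pred (Fin (suc m)) 0ℓ} (P? : Decidable P) → ¬ P zero →
              # P? ≡ # (P? ∘ suc)
  #-zero-no P? ¬p = trans (cong length (filter-reject P? ¬p)) (#-suc P?)

  #-tail : {P : Pred (Fin (suc m)) 0ℓ} (P? : Decidable P) → # (P? ∘ suc) ℕ.≤ # P?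
  #-tail P? with P? zero
  ... | yes p = ℕ.≤-trans (ℕ.n≤1+n _) (ℕ.≤-reflexive (cong suc (sym (#-suc P?))))
  ... | no ¬p = ℕ.≤-reflexive (sym (#-suc P?))

  length-filter-mono : {P Q R : Pred A 0ℓ} (P? : Decidable P) (Q? : Decidable Q) (R? : Decidable R) →
                       (∀ x → P x → Q x × R x) →
                       ∀ xs → length (filter P? xs) ℕ.≤ length (filter Q? (filter R? xs))
  length-filter-mono P? Q? R? P⊆ [] = z≤n
  length-filter-mono P? Q? R? P⊆ (x ∷ xs) with ih ← length-filter-mono P? Q? R? P⊆ xs | P? x | R? x
  ... | no ¬p | no ¬r = ih
  ... | yes p | no ¬r = contradiction (proj₂ (P⊆ x p)) ¬r
  ... | p? | yes r with Q? x
  ...   | yes q with p?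
  ...     | yes p = s≤s ih
  ...     | no ¬p = ℕ.m≤n⇒m≤1+n ih
  length-filter-mono P? Q? R? P⊆ (x ∷ xs) | p? | yes r | no ¬q with p?
  ...     | yes p = contradiction (proj₁ (P⊆ x p)) ¬q
  ...     | no ¬p = ih

  #-mono : {P Q : Pred (Fin m) 0ℓ} (P? : Decidable P) (Q? : Decidable Q) →
           (∀ i → P i → Q i) → # P? ℕ.≤ # Q?
  #-mono P? Q? P⊆Q = ℕ.≤-trans
    (length-filter-mono P? Q? (λ _ → yes tt) (λ i p → P⊆Q i p , tt) (allFin _))
    (ℕ.≤-reflexive (cong (length ∘ filter Q?) (filter-all (λ _ → yes tt) (All.universal (λ _ → tt) (allFin _)))))

  #-none : {P : Pred (Fin m) 0ℓ} (P? : Decidable P) → (∀ i → ¬ P i) → # P? ≡ 0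
  #-none P? ¬P = cong length (filter-none P? (All.universal ¬P (allFin _)))

  map-allFin-↭ : (ρ : Permutation′ m) → map (ρ ⟨$⟩ʳ_) (allFin m) ↭ allFin m
  map-allFin-↭ {m} ρ = ∼bag⇒↭ (unique∧set⇒bag
    (Unique.map⁺ (Injection.injective (↔⇒↣ ρ)) (Unique.allFin⁺ m)) (Unique.allFin⁺ m)
    (λ {x} → mk⇔ (λ _ → ∈-allFin x)
         (λ _ → subst (_∈ map (ρ ⟨$⟩ʳ_) (allFin m)) (inverseʳ ρ) (∈-map⁺ (ρ ⟨$⟩ʳ_) (∈-allFin (ρ ⟨$⟩ˡ x))))))

  #-permute : {P : Pred (Fin m) 0ℓ} (P? : Decidable P) (ρ : Permutation′ m) →
              # (P? ∘ (ρ ⟨$⟩ʳ_)) ≡ # P?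
  #-permute {m} P? ρ = trans (sym (length-filter-map P? (ρ ⟨$⟩ʳ_) (allFin m)))
                             (↭-length (filter-↭ P? (map-allFin-↭ ρ)))

  -- Crossings of the level x by a word h, for words that need not be permutations.
  module Crossing {M} (x : Fin M) where

    Down Low : (Fin m → Fin M) → Pred (Fin m) 0ℓ
    Down h j = ∃[ j′ ] Consecutive j j′ × h j′ < x × x < h j
    Low  h j = h j < x × ¬ (∃[ j′ ] Consecutive j j′ × h j′ < h j)

    down? : (h : Fin m → Fin M) → Decidable (Down h)
    down? h j = any? λ j′ → (toℕ j′ ℕ.≟ _) ×-dec ((_ <? x) ×-dec (x <? _))

    low? : (h : Fin m → Fin M) → Decidable (Low h)
    low? h j = (h j <? x) ×-dec ¬? (any? λ j′ → (toℕ j′ ℕ.≟ _) ×-dec (_ <? _))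

    down-suc : (h : Fin (suc m) → Fin M) {j : Fin m} → Down h (suc j) → Down (h ∘ suc) j
    down-suc h (suc j′ , eq , p) = j′ , ℕ.suc-injective eq , p

    suc-down : (h : Fin (suc m) → Fin M) {j : Fin m} → Down (h ∘ suc) j → Down h (suc j)
    suc-down h (j′ , eq , p) = suc j′ , cong suc eq , p

    suc-low : (h : Fin (suc m) → Fin M) {j : Fin m} → Low (h ∘ suc) j → Low h (suc j)
    suc-low h (p , ¬q) = p , λ { (suc j′ , eq , q) → ¬q (j′ , ℕ.suc-injective eq , q) }

    #down-tail : (h : Fin (suc m) → Fin M) → # (down? h ∘ suc) ℕ.≤ # (down? (h ∘ suc))
    #down-tail h = #-mono (down? h ∘ suc) (down? (h ∘ suc)) (λ _ → down-suc h)

    #low-tail : (h : Fin (suc m) → Fin M) → # (low? (h ∘ suc)) ℕ.≤ # (low? h ∘ suc)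
    #low-tail h = #-mono (low? (h ∘ suc)) (low? h ∘ suc) (λ _ → suc-low h)

    ≮∧≢⇒> : {y : Fin M} → ¬ (y < x) → y ≢ x → x < y
    ≮∧≢⇒> {y} ≮ ≢ with <-cmp y x
    ... | tri< lt _ _ = contradiction lt ≮
    ... | tri≈ _ eq _ = contradiction eq ≢
    ... | tri> _ _ gt = gt

    down≤low : (h : Fin (suc m) → Fin M) → (∀ j → h j ≢ x) →
               (x < h zero → # (down? h) ℕ.≤ # (low? h)) ×
               (h zero < x → # (down? h) ℕ.< # (low? h))
    down≤low {zero} h h≢x =
        (λ _ → subst (ℕ._≤ # (low? h)) (sym (#-none (down? h) ¬down)) z≤n)
      , (λ lt → subst (ℕ._< # (low? h)) (sym (#-none (down? h) ¬down))
                  (filter-some (low? h) (here (lt , λ { (zero , () , _) }))))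
      where
      ¬down : ∀ j → ¬ Down h j
      ¬down zero (zero , () , _)
    down≤low {suc m} h h≢x = high (h (suc zero) <? x) , low (h (suc zero) <? x)
      where
      open ℕ.≤-Reasoning
      h′ = h ∘ suc
      ih = down≤low h′ (h≢x ∘ suc)
      low⊇ : # (low? h′) ℕ.≤ # (low? h)
      low⊇ = ℕ.≤-trans (#low-tail h) (#-tail (low? h))
      high : Dec (h′ zero < x) → x < h zero → # (down? h) ℕ.≤ # (low? h)
      high (yes lt) x<h₀ = begin
        # (down? h)                 ≡⟨ #-zero-yes (down? h) (suc zero , refl , lt , x<h₀) ⟩
        suc (# (down? h ∘ suc))     ≤⟨ s≤s (#down-tail h) ⟩
        suc (# (down? h′))          ≤⟨ proj₂ ih lt ⟩
        # (low? h′)                 ≤⟨ low⊇ ⟩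
        # (low? h)                  ∎
      high (no ≮) x<h₀ = begin
        # (down? h)                 ≡⟨ #-zero-no (down? h) (λ { (suc zero , _ , lt , _) → ≮ lt ; (suc (suc _) , () , _) }) ⟩
        # (down? h ∘ suc)           ≤⟨ #down-tail h ⟩
        # (down? h′)                ≤⟨ proj₁ ih (≮∧≢⇒> ≮ (h≢x (suc zero))) ⟩
        # (low? h′)                 ≤⟨ low⊇ ⟩
        # (low? h)                  ∎
      low : Dec (h′ zero < x) → h zero < x → # (down? h) ℕ.< # (low? h)
      low (yes lt) h₀<x = begin
        suc (# (down? h))           ≡⟨ cong suc (#-zero-no (down? h) (λ { (_ , _ , _ , x<h₀) → <-asym x<h₀ h₀<x })) ⟩
        suc (# (down? h ∘ suc))     ≤⟨ s≤s (#down-tail h) ⟩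
        suc (# (down? h′))          ≤⟨ proj₂ ih lt ⟩
        # (low? h′)                 ≤⟨ low⊇ ⟩
        # (low? h)                  ∎
      low (no ≮) h₀<x = begin
        suc (# (down? h))           ≡⟨ cong suc (#-zero-no (down? h) (λ { (_ , _ , _ , x<h₀) → <-asym x<h₀ h₀<x })) ⟩
        suc (# (down? h ∘ suc))     ≤⟨ s≤s (#down-tail h) ⟩
        suc (# (down? h′))          ≤⟨ s≤s (proj₁ ih x<h₁) ⟩
        suc (# (low? h′))           ≤⟨ s≤s (#low-tail h) ⟩
        suc (# (low? h ∘ suc))      ≡⟨ #-zero-yes (low? h) (h₀<x , λ { (suc zero , _ , h₁<h₀) → <-asym h₁<h₀ (ℕ.<-trans h₀<x x<h₁) ; (suc (suc _) , () , _) }) ⟨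
        # (low? h)                  ∎
        where x<h₁ = ≮∧≢⇒> ≮ (h≢x (suc zero))

    down-exists : (h : Fin (suc m) → Fin M) → (∀ j → h j ≢ x) →
                  x < h zero → h (fromℕ m) < x → ∃ (Down h)
    down-exists {zero}  h h≢x gt lt = contradiction lt (<-asym gt)
    down-exists {suc m} h h≢x gt lt with h (suc zero) <? x
    ... | yes h₁<x = zero , suc zero , refl , h₁<x , gt
    ... | no ≮ =
      let j , d = down-exists (h ∘ suc) (h≢x ∘ suc) (≮∧≢⇒> ≮ (h≢x (suc zero))) lt
      in suc j , suc-down h d

    later? : (h : Fin m → Fin M) (i : Fin m) → Decidable (λ j → i < j × Down h j)
    later? h i j = (i <? j) ×-dec down? h j

    NonTop : (Fin m → Fin M) → Pred (Fin m) 0ℓ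
    NonTop h i = ∀ j → Consecutive i j → ¬ (h j < x)

    later≤low : (h : Fin m → Fin M) (i : Fin m) → (∀ j → i < j → h j ≢ x) →
                NonTop h i → # (later? h i) ℕ.≤ # (low? h)
    later≤low {suc zero} h zero h≢x nt = subst (ℕ._≤ # (low? h))
      (sym (#-none (later? h zero) λ { zero (() , _) })) z≤n
    later≤low {suc (suc m)} h zero h≢x nt = begin
      # (later? h zero)         ≡⟨ #-zero-no (later? h zero) (λ { (() , _) }) ⟩
      # (later? h zero ∘ suc)   ≤⟨ #-mono (later? h zero ∘ suc) (down? (h ∘ suc)) (λ { _ (_ , d) → down-suc h d }) ⟩
      # (down? (h ∘ suc))       ≤⟨ proj₁ (down≤low (h ∘ suc) (λ j → h≢x (suc j) (s≤s z≤n))) (≮∧≢⇒> (nt (suc zero) refl) (h≢x (suc zero) (s≤s z≤n))) ⟩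
      # (low? (h ∘ suc))        ≤⟨ #low-tail h ⟩
      # (low? h ∘ suc)          ≤⟨ #-tail (low? h) ⟩
      # (low? h)                ∎
      where open ℕ.≤-Reasoning
    later≤low {suc m} h (suc i) h≢x nt = begin
      # (later? h (suc i))       ≡⟨ #-zero-no (later? h (suc i)) (λ { (() , _) }) ⟩
      # (later? h (suc i) ∘ suc) ≤⟨ #-mono (later? h (suc i) ∘ suc) (later? (h ∘ suc) i) (λ { _ (s≤s lt , d) → lt , down-suc h d }) ⟩
      # (later? (h ∘ suc) i)     ≤⟨ later≤low (h ∘ suc) i (λ j lt → h≢x (suc j) (s≤s lt)) (λ j eq → nt (suc j) (cong suc eq)) ⟩
      # (low? (h ∘ suc))         ≤⟨ #low-tail h ⟩
      # (low? h ∘ suc)           ≤⟨ #-tail (low? h) ⟩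
      # (low? h)                 ∎
      where open ℕ.≤-Reasoning

    later-exists : (h : Fin (suc m) → Fin M) (i : Fin (suc m)) → (∀ j → i < j → h j ≢ x) →
                   NonTop h i → i ≢ fromℕ m → h (fromℕ m) < x → ∃[ j ] i < j × Down h j
    later-exists {zero}  h zero h≢x nt i≢ lt = contradiction refl i≢
    later-exists {suc m} h zero h≢x nt i≢ lt =
      let j , d = down-exists (h ∘ suc) (λ j → h≢x (suc j) (s≤s z≤n))
                    (≮∧≢⇒> (nt (suc zero) refl) (h≢x (suc zero) (s≤s z≤n))) lt
      in suc j , s≤s z≤n , suc-down h d
    later-exists {suc m} h (suc i) h≢x nt i≢ lt =
      let j , i<j , d = later-exists (h ∘ suc) i (λ j lt → h≢x (suc j) (s≤s lt))
                    (λ j eq → nt (suc j) (cong suc eq)) (i≢ ∘ cong suc) lt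
      in suc j , s≤s i<j , suc-down h d

  index : {w : List (Fin m)} → w ↭ allFin m → Permutation (length w) m
  index {m} w↭ = onIndices (↭⇒↭ₛ w↭) ∘ₚ cast-id (length-tabulate {n = m} id)

  index-lookup : {w : List (Fin m)} (w↭ : w ↭ allFin m) → ∀ i → lookup w i ≡ index w↭ ⟨$⟩ʳ i
  index-lookup {m} w↭ i = trans (onIndices-lookup (setoid _) (↭⇒↭ₛ w↭) i)
    (trans (cong (lookup (allFin m)) (sym (cast-involutive (sym len) len j)))
           (lookup-tabulate id (cast len j)))
    where
    len : length (allFin m) ≡ m
    len = length-tabulate {n = m} id
    j : Fin (length (allFin m))
    j = onIndices (↭⇒↭ₛ w↭) ⟨$⟩ʳ i

  two-row : {as bs : List (Fin m)} → as ↭ allFin m → bs ↭ allFin m →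
            ∃[ τ ] Pointwise (λ a b → τ ⟨$⟩ʳ b ≡ a) as bs
  two-row {m} {as} {bs} as↭ bs↭ = τ , Pointwise.lookup⁻ len λ {i} {j} i≡j → begin
    index as↭ ⟨$⟩ʳ cast (sym len) (index bs↭ ⟨$⟩ˡ lookup bs j)        ≡⟨ cong (λ b → index as↭ ⟨$⟩ʳ cast (sym len) (index bs↭ ⟨$⟩ˡ b)) (index-lookup bs↭ j) ⟩
    index as↭ ⟨$⟩ʳ cast (sym len) (index bs↭ ⟨$⟩ˡ (index bs↭ ⟨$⟩ʳ j)) ≡⟨ cong (λ k → index as↭ ⟨$⟩ʳ cast (sym len) k) (inverseˡ (index bs↭)) ⟩
    index as↭ ⟨$⟩ʳ cast (sym len) j ≡⟨ cong (index as↭ ⟨$⟩ʳ_) (toℕ-injective (trans (toℕ-cast (sym len) j) (sym i≡j))) ⟩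
    index as↭ ⟨$⟩ʳ i                                          ≡⟨ index-lookup as↭ i ⟨
    lookup as i                                               ∎
    where
    open ≡-Reasoning
    len : length as ≡ length bs
    len = trans (↭-length as↭) (sym (↭-length bs↭))
    τ : Permutation′ m
    τ = flip (index bs↭) ∘ₚ cast-id (sym len) ∘ₚ index as↭

  two-row-unique : (τ τ′ : Permutation′ m) {as bs : List (Fin m)} →
                   Pointwise (λ a b → τ ⟨$⟩ʳ b ≡ a) as bs → Pointwise (λ a b → τ′ ⟨$⟩ʳ b ≡ a) as bs →
                   ∀ {b} → b ∈ bs → τ ⟨$⟩ʳ b ≡ τ′ ⟨$⟩ʳ b
  two-row-unique τ τ′ (e ∷ _)  (e′ ∷ _)   (here refl) = trans e (sym e′)
  two-row-unique τ τ′ (_ ∷ es) (_ ∷ es′) (there b∈)  = two-row-unique τ τ′ es es′ b∈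

  filter-split : {P : Pred A 0ℓ} (P? : Decidable P) (xs : List A) →
                 filter P? xs ++ filter (¬? ∘ P?) xs ↭ xs
  filter-split P? [] = ↭-refl
  filter-split P? (x ∷ xs) with P? x
  ... | yes _ = ↭-prep x (filter-split P? xs)
  ... | no  _ = ↭-trans (shift x (filter P? xs) (filter (¬? ∘ P?) xs)) (↭-prep x (filter-split P? xs))

  reverse-split : (w ys : List A) {x : A} {zs : List A} → List.reverse w ≡ ys ++ x ∷ zs →
                  w ≡ List.reverse zs ++ x ∷ List.reverse ys
  reverse-split w ys {x} {zs} eq = begin
    w                                              ≡⟨ reverse-involutive w ⟨
    List.reverse (List.reverse w)                  ≡⟨ cong List.reverse eq ⟩
    List.reverse (ys ++ x ∷ zs)                    ≡⟨ reverse-++ ys (x ∷ zs) ⟩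
    List.reverse (x ∷ zs) ++ List.reverse ys       ≡⟨ cong (_++ List.reverse ys) (unfold-reverse x zs) ⟩
    (List.reverse zs ∷ʳ x) ++ List.reverse ys      ≡⟨ ++-assoc (List.reverse zs) (x ∷ []) (List.reverse ys) ⟩
    List.reverse zs ++ x ∷ List.reverse ys         ∎
    where open ≡-Reasoning

  length-filter-reverse : {P : Pred A 0ℓ} (P? : Decidable P) (xs : List A) →
                          length (filter P? (List.reverse xs)) ≡ length (filter P? xs)
  length-filter-reverse P? xs = ↭-length (filter-↭ P? (↭-reverse xs))

  reverse-AllPairs : {R : Rel A 0ℓ} {xs : List A} → AllPairs R xs →
                     AllPairs (λ x y → R y x) (List.reverse xs)
  reverse-AllPairs [] = []
  reverse-AllPairs {R = R} {x ∷ xs} (x~ ∷ xs~) = subst (AllPairs _) (sym (unfold-reverse x xs))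
    (AllPairs.++⁺ (reverse-AllPairs xs~) ([] ∷ [])
      (All-resp-↭ (↭-sym (↭-reverse xs)) (All.map (_∷ []) x~)))

  allFin-increasing : AllPairs _<_ (allFin m)
  allFin-increasing = AllPairs.tabulate⁺-< id

  module _ (ρ : Permutation′ m) where

    module ↑ = Arrangement _<?_ <-asym (crossings ρ)
    module ↓ = Arrangement {_≺_ = λ x y → y < x} (λ x y → y <? x) <-asym (crossings ρ)

    ↓⇒right : ∀ {w} → ↓.Coded w → SmallerToRight (crossings ρ) (List.reverse w)
    ↓⇒right {w} code ys x zs eq = trans (sym (length-filter-reverse (_<? x) zs))
      (code (List.reverse zs) x (List.reverse ys) (reverse-split w ys eq))

    right⇒↓ : ∀ {w} → SmallerToRight (crossings ρ) w → ↓.Coded (List.reverse w)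
    right⇒↓ {w} code ys x zs eq = trans (sym (length-filter-reverse (_<? x) ys))
      (code (List.reverse zs) x (List.reverse ys) (reverse-split w ys eq))

    descentTop-at : ∀ {j j′} → Consecutive j j′ → (ρ ⟨$⟩ʳ j′) < (ρ ⟨$⟩ʳ j) → DescentTop ρ (ρ ⟨$⟩ʳ j)
    descentTop-at {j} {j′} eq lt = j′ , trans eq (cong (suc ∘ toℕ) (sym (inverseˡ ρ))) , lt

    at-descentTop : ∀ {j} → DescentTop ρ (ρ ⟨$⟩ʳ j) →
                    ∃[ j′ ] Consecutive j j′ × (ρ ⟨$⟩ʳ j′) < (ρ ⟨$⟩ʳ j)
    at-descentTop (j′ , eq , lt) = j′ , trans eq (cong (suc ∘ toℕ) (inverseˡ ρ)) , lt

    later≢ : ∀ {x} j → (ρ ⟨$⟩ˡ x) < j → ρ ⟨$⟩ʳ j ≢ x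
    later≢ j lt refl = <-irrefl (inverseˡ ρ) lt

    nonTop : ∀ {x} → ¬ DescentTop ρ x → Crossing.NonTop x (ρ ⟨$⟩ʳ_) (ρ ⟨$⟩ˡ x)
    nonTop ¬top j eq lt = ¬top (j , eq , lt)

    tops-bound : ∀ x → crossings ρ x ℕ.≤ ↑.above x (descentTops ρ)
    tops-bound x = begin
      crossings ρ x                ≤⟨ #-mono (λ j → ((ρ ⟨$⟩ˡ x) <? j) ×-dec crossedAt? ρ x j) (Q? ∘ (ρ ⟨$⟩ʳ_))
                                        (λ { j (_ , j′ , eq , lt , gt) → gt , descentTop-at eq (ℕ.<-trans lt gt) }) ⟩
      # (Q? ∘ (ρ ⟨$⟩ʳ_))           ≡⟨ #-permute Q? ρ ⟩
      # Q?                         ≤⟨ length-filter-mono Q? (x <?_) (descentTop? ρ) (λ _ q → q) (allFin m) ⟩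
      ↑.above x (descentTops ρ)    ∎
      where
      open ℕ.≤-Reasoning
      Q? = λ y → (x <? y) ×-dec descentTop? ρ y

    nontops-bound : ∀ x → ¬ DescentTop ρ x → crossings ρ x ℕ.≤ ↓.above x (nondescentTops ρ)
    nontops-bound x ¬top = begin
      crossings ρ x                ≤⟨ later≤low (ρ ⟨$⟩ʳ_) (ρ ⟨$⟩ˡ x) later≢ (nonTop ¬top) ⟩
      # (low? (ρ ⟨$⟩ʳ_))           ≤⟨ #-mono (low? (ρ ⟨$⟩ʳ_)) (Q? ∘ (ρ ⟨$⟩ʳ_)) (λ { j (lt , ¬d) → lt , ¬d ∘ at-descentTop }) ⟩
      # (Q? ∘ (ρ ⟨$⟩ʳ_))           ≡⟨ #-permute Q? ρ ⟩
      # Q?                         ≤⟨ length-filter-mono Q? (_<? x) (¬? ∘ descentTop? ρ) (λ _ q → q) (allFin m) ⟩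
      ↓.above x (nondescentTops ρ) ∎
      where
      open ℕ.≤-Reasoning
      open Crossing x
      Q? = λ y → (y <? x) ×-dec ¬? (descentTop? ρ y)

    tops-increasing : AllPairs _<_ (descentTops ρ)
    tops-increasing = AllPairs.filter⁺ (descentTop? ρ) allFin-increasing

    nontops-decreasing : AllPairs (λ x y → y < x) (List.reverse (nondescentTops ρ))
    nontops-decreasing = reverse-AllPairs (AllPairs.filter⁺ (¬? ∘ descentTop? ρ) allFin-increasing)

    f′g′-↭ : ∀ {f′ g′} → f′ ↭ descentTops ρ → g′ ↭ nondescentTops ρ → f′ ++ g′ ↭ allFin m
    f′g′-↭ f′↭ g′↭ = ↭-trans (++⁺ f′↭ g′↭) (filter-split (descentTop? ρ) (allFin m))

    Φ-exists : ∃ (IsΦ ρ)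
    Φ-exists =
      let f′ , f′↭ , f′-code = ↑.arrange tops-increasing (λ {x} _ → tops-bound x)
          w , w↭ , w-code = ↓.arrange nontops-decreasing λ {x} x∈ →
            subst (crossings ρ x ℕ.≤_) (sym (length-filter-reverse (_<? x) (nondescentTops ρ)))
              (nontops-bound x (proj₂ (∈-filter⁻ (¬? ∘ descentTop? ρ) {xs = allFin m}
                (∈-resp-↭ (↭-reverse (nondescentTops ρ)) x∈))))
          g′↭ = ↭-trans (↭-reverse w) (↭-trans w↭ (↭-reverse (nondescentTops ρ)))
          τ , columns = two-row (filter-split (descentBottom? ρ) (allFin m)) (f′g′-↭ f′↭ g′↭)
      in τ , record
        { f′ = f′ ; g′ = List.reverse w
        ; f′-letters = f′↭ ; f′-code = f′-code
        ; g′-letters = g′↭ ; g′-code = ↓⇒right w-code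
        ; columns = columns }

Φ-unique : (ρ : Permutation′ m) {τ τ′ : Permutation′ m} → IsΦ ρ τ → IsΦ ρ τ′ → τ ≈ τ′
Φ-unique ρ {τ} {τ′} p q b = two-row-unique τ τ′ P.columns columns′
  (∈-resp-↭ (↭-sym (f′g′-↭ ρ P.f′-letters P.g′-letters)) (∈-allFin b))
  where
  module P = IsΦ p
  module Q = IsΦ q
  f′≡ : Q.f′ ≡ P.f′
  f′≡ = ↑.arrange-unique ρ (tops-increasing ρ) Q.f′-letters P.f′-letters Q.f′-code P.f′-code
  reversed : ∀ {w} → w ↭ nondescentTops ρ → List.reverse w ↭ List.reverse (nondescentTops ρ)
  reversed {w} w↭ = ↭-trans (↭-reverse w) (↭-trans w↭ (↭-sym (↭-reverse (nondescentTops ρ))))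
  g′≡ : Q.g′ ≡ P.g′
  g′≡ = reverse-injective (↓.arrange-unique ρ (nontops-decreasing ρ)
    (reversed Q.g′-letters) (reversed P.g′-letters) (right⇒↓ ρ Q.g′-code) (right⇒↓ ρ P.g′-code))
  columns′ : Pointwise (λ a b → τ′ ⟨$⟩ʳ b ≡ a) (descentBottoms ρ ++ nondescentBottoms ρ) (P.f′ ++ P.g′)
  columns′ = subst (Pointwise _ _) (cong₂ _++_ f′≡ g′≡) Q.columns

private
  from-cong : {ρ ρ′ : Permutation′ m} → ρ ≈ ρ′ → ∀ x → ρ ⟨$⟩ˡ x ≡ ρ′ ⟨$⟩ˡ x
  from-cong {ρ = ρ} {ρ′} ρ≈ x = trans (sym (inverseˡ ρ′))
    (cong (ρ′ ⟨$⟩ˡ_) (trans (sym (ρ≈ (ρ ⟨$⟩ˡ x))) (inverseʳ ρ)))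

  module _ {ρ ρ′ : Permutation′ m} (ρ≈ : ρ ≈ ρ′) where

    top⇒ : ∀ {x} → DescentTop ρ x → DescentTop ρ′ x
    top⇒ {x} (j , eq , lt) =
      j , trans eq (cong (suc ∘ toℕ) (from-cong {ρ = ρ} {ρ′} ρ≈ x)) , subst (_< x) (ρ≈ j) lt

    bottom⇒ : ∀ {x} → DescentBottom ρ x → DescentBottom ρ′ x
    bottom⇒ {x} (i , eq , lt) =
      i , trans (cong toℕ (sym (from-cong {ρ = ρ} {ρ′} ρ≈ x))) eq , subst (x <_) (ρ≈ i) lt

    crossing⇒ : ∀ {x j} → (ρ ⟨$⟩ˡ x) < j × CrossedAt ρ x j → (ρ′ ⟨$⟩ˡ x) < j × CrossedAt ρ′ x j
    crossing⇒ {x} {j} (lt , j′ , eq , below , above) =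
      subst (_< j) (from-cong {ρ = ρ} {ρ′} ρ≈ x) lt
      , j′ , eq , subst (_< x) (ρ≈ j′) below , subst (x <_) (ρ≈ j) above

  IsΦ-resp : {ρ ρ′ τ : Permutation′ m} → ρ ≈ ρ′ → IsΦ ρ τ → IsΦ ρ′ τ
  IsΦ-resp {m} {ρ} {ρ′} {τ} ρ≈ p = record
    { f′ = f′ ; g′ = g′
    ; f′-letters = subst (f′ ↭_) (filter-≐ (descentTop? ρ) (descentTop? ρ′) tops≐ (allFin m)) f′-letters
    ; f′-code = λ ys x zs eq → trans (f′-code ys x zs eq) (crossings≡ x)
    ; g′-letters = subst (g′ ↭_) (filter-≐ (¬? ∘ descentTop? ρ) (¬? ∘ descentTop? ρ′)
        ((_∘ proj₂ tops≐) , (_∘ proj₁ tops≐)) (allFin m)) g′-letters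
    ; g′-code = λ ys x zs eq → trans (g′-code ys x zs eq) (crossings≡ x)
    ; columns = subst (λ as → Pointwise (λ a b → τ ⟨$⟩ʳ b ≡ a) as (f′ ++ g′))
        (cong₂ _++_
          (filter-≐ (descentBottom? ρ) (descentBottom? ρ′) bottoms≐ (allFin m))
          (filter-≐ (¬? ∘ descentBottom? ρ) (¬? ∘ descentBottom? ρ′)
            ((_∘ proj₂ bottoms≐) , (_∘ proj₁ bottoms≐)) (allFin m)))
        columns }
    where
    open IsΦ p
    ≈ρ : ρ′ ≈ ρ
    ≈ρ i = sym (ρ≈ i)
    tops≐ : DescentTop ρ ≐ DescentTop ρ′
    tops≐ = top⇒ {ρ = ρ} {ρ′} ρ≈ , top⇒ {ρ = ρ′} {ρ} ≈ρ
    bottoms≐ : DescentBottom ρ ≐ DescentBottom ρ′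
    bottoms≐ = bottom⇒ {ρ = ρ} {ρ′} ρ≈ , bottom⇒ {ρ = ρ′} {ρ} ≈ρ
    crossings≡ : ∀ x → crossings ρ x ≡ crossings ρ′ x
    crossings≡ x = cong length (filter-≐
      (λ j → ((ρ ⟨$⟩ˡ x) <? j) ×-dec crossedAt? ρ x j)
      (λ j → ((ρ′ ⟨$⟩ˡ x) <? j) ×-dec crossedAt? ρ′ x j)
      (crossing⇒ {ρ = ρ} {ρ′} ρ≈ , crossing⇒ {ρ = ρ′} {ρ} ≈ρ) (allFin m))

-- By Φ-isΦ and Φ-unique, Φ ρ is the only permutation, up to _≈_, with IsΦ ρ (Φ ρ).
Φ : Permutation′ m → Permutation′ m
Φ ρ = proj₁ (Φ-exists ρ)

Φ-isΦ : (ρ : Permutation′ m) → IsΦ ρ (Φ ρ)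
Φ-isΦ ρ = proj₂ (Φ-exists ρ)

Φ-cong : {ρ ρ′ : Permutation′ m} → ρ ≈ ρ′ → Φ ρ ≈ Φ ρ′
Φ-cong {ρ = ρ} {ρ′} ρ≈ = Φ-unique ρ′ (IsΦ-resp {ρ = ρ} {ρ′} ρ≈ (Φ-isΦ ρ)) (Φ-isΦ ρ′)

-- The word (σ(1)+1) ⋯ (σ(n)+1) 1.
hat : Permutation′ n → Permutation′ (suc n)
hat {n} σ = insert (fromℕ n) zero σ

private
  punchIn-fromℕ : (i : Fin n) → punchIn (fromℕ n) i ≡ inject₁ i
  punchIn-fromℕ zero    = refl
  punchIn-fromℕ (suc i) = cong suc (punchIn-fromℕ i)

  allFin-∷ʳ : ∀ n → ∃[ xs ] allFin (suc n) ≡ xs ∷ʳ fromℕ n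
  allFin-∷ʳ zero = [] , refl
  allFin-∷ʳ (suc n) with allFin-∷ʳ n
  ... | xs , eq = zero ∷ map suc xs , cong (zero ∷_) (begin
    tabulate suc                ≡⟨ map-tabulate id suc ⟨
    map suc (allFin (suc n))    ≡⟨ cong (map suc) eq ⟩
    map suc (xs ∷ʳ fromℕ n)     ≡⟨ map-++ suc xs (fromℕ n ∷ []) ⟩
    map suc xs ∷ʳ fromℕ (suc n) ∎)
    where open ≡-Reasoning

  map-two-row : (τ : Permutation′ m) {as bs : List (Fin m)} →
                Pointwise (λ a b → τ ⟨$⟩ʳ b ≡ a) as bs → map (τ ⟨$⟩ʳ_) bs ≡ as
  map-two-row τ []       = refl
  map-two-row τ (e ∷ es) = cong₂ _∷_ e (map-two-row τ es)

hat-inject₁ : (σ : Permutation′ n) (i : Fin n) → hat σ ⟨$⟩ʳ inject₁ i ≡ suc (σ ⟨$⟩ʳ i)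
hat-inject₁ {n} σ i = trans (cong (hat σ ⟨$⟩ʳ_) (sym (punchIn-fromℕ i))) (insert-punchIn (fromℕ n) zero σ i)

hat-fromℕ : (σ : Permutation′ n) → hat σ ⟨$⟩ʳ fromℕ n ≡ zero
hat-fromℕ {n} σ with fromℕ n ≟ fromℕ n
... | yes _ = refl
... | no ≢  = contradiction refl ≢

private
  module _ (σ : Permutation′ n) where

    ρ = hat σ

    zero-nonTop : zero ∈ nondescentTops ρ
    zero-nonTop = ∈-filter⁺ (¬? ∘ descentTop? ρ) (∈-allFin zero) λ { (_ , _ , ()) }

    nonBottoms-∷ʳ : ∃[ u ] nondescentBottoms ρ ≡ u ∷ʳ fromℕ n
    nonBottoms-∷ʳ =
      let xs , eq = allFin-∷ʳ n
          P? = ¬? ∘ descentBottom? ρ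
      in filter P? xs , (begin
        filter P? (allFin (suc n))                 ≡⟨ cong (filter P?) eq ⟩
        filter P? (xs ∷ʳ fromℕ n)                  ≡⟨ filter-++ P? xs (fromℕ n ∷ []) ⟩
        filter P? xs ++ filter P? (fromℕ n ∷ [])   ≡⟨ cong (filter P? xs ++_) (filter-accept P? (λ { (i , _ , lt) →
                                                        ℕ.<⇒≱ lt (≤fromℕ (ρ ⟨$⟩ʳ i)) })) ⟩
        filter P? xs ∷ʳ fromℕ n                    ∎)
      where open ≡-Reasoning

    uncrossed⇒zero : ∀ {y} → ¬ DescentTop ρ y → crossings ρ y ≡ 0 → y ≡ zero
    uncrossed⇒zero {zero}  _    _  = refl
    uncrossed⇒zero {suc y} ¬top eq =
      let j , p = Crossing.later-exists (suc y) (ρ ⟨$⟩ʳ_) (ρ ⟨$⟩ˡ suc y) (later≢ ρ) (nonTop ρ ¬top)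
                    (λ at → contradiction (trans (sym (inverseʳ ρ {suc y})) (trans (cong (ρ ⟨$⟩ʳ_) at) (hat-fromℕ σ))) λ ())
                    (subst (_< suc y) (sym (hat-fromℕ σ)) (s≤s z≤n))
      in contradiction eq (ℕ.>⇒≢ (filter-some (Crossing.later? (suc y) (ρ ⟨$⟩ʳ_) (ρ ⟨$⟩ˡ suc y))
           (lose (∈-allFin j) p)))

    IsΦ-hat-zero : ∀ {τ} → IsΦ ρ τ → τ ⟨$⟩ʳ zero ≡ fromℕ n
    IsΦ-hat-zero {τ} p = last g′ refl
      where
      open IsΦ p
      last : ∀ w → g′ ≡ w → τ ⟨$⟩ʳ zero ≡ fromℕ n
      last w eq with List.initLast w
      ... | List.[] = contradiction
        (subst (zero ∈_) eq (∈-resp-↭ (↭-sym g′-letters) zero-nonTop)) λ ()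
      ... | v List.∷ʳ′ y = ∷ʳ-injectiveʳ (map (τ ⟨$⟩ʳ_) (f′ ++ v)) (descentBottoms ρ ++ u) (begin
        map (τ ⟨$⟩ʳ_) (f′ ++ v) ∷ʳ (τ ⟨$⟩ʳ zero)         ≡⟨ cong (λ b → map (τ ⟨$⟩ʳ_) (f′ ++ v) ∷ʳ (τ ⟨$⟩ʳ b)) y≡0 ⟨
        map (τ ⟨$⟩ʳ_) (f′ ++ v) ∷ʳ (τ ⟨$⟩ʳ y)            ≡⟨ map-++ (τ ⟨$⟩ʳ_) (f′ ++ v) (y ∷ []) ⟨
        map (τ ⟨$⟩ʳ_) ((f′ ++ v) ∷ʳ y)                   ≡⟨ cong (map (τ ⟨$⟩ʳ_)) (trans (++-assoc f′ v (y ∷ [])) (cong (f′ ++_) (sym eq))) ⟩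
        map (τ ⟨$⟩ʳ_) (f′ ++ g′)                         ≡⟨ map-two-row τ columns ⟩
        descentBottoms ρ ++ nondescentBottoms ρ          ≡⟨ cong (descentBottoms ρ ++_) u≡ ⟩
        descentBottoms ρ ++ (u ∷ʳ fromℕ n)               ≡⟨ ++-assoc (descentBottoms ρ) u (fromℕ n ∷ []) ⟨
        (descentBottoms ρ ++ u) ∷ʳ fromℕ n               ∎)
        where
        open ≡-Reasoning
        u  = proj₁ nonBottoms-∷ʳ
        u≡ = proj₂ nonBottoms-∷ʳ
        y∈ : y ∈ nondescentTops ρ
        y∈ = ∈-resp-↭ g′-letters (subst (y ∈_) (sym eq) (∈-++⁺ʳ v (here refl)))
        y≡0 : y ≡ zero
        y≡0 = uncrossed⇒zero (proj₂ (∈-filter⁻ (¬? ∘ descentTop? ρ) {xs = allFin (suc n)} y∈))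
                             (sym (g′-code v y [] eq))

Φ-hat-zero : (σ : Permutation′ n) → Φ (hat σ) ⟨$⟩ʳ zero ≡ fromℕ n
Φ-hat-zero σ = IsΦ-hat-zero σ (Φ-isΦ (hat σ))

-- Since Φ (hat σ) begins with its largest letter, deleting that letter leaves the
-- other letters unchanged: see Ψ-letter.
Ψ : Permutation′ n → Permutation′ n
Ψ σ = remove zero (Φ (hat σ))

Ψ-letter : (σ : Permutation′ n) (i : Fin n) → inject₁ (Ψ σ ⟨$⟩ʳ i) ≡ Φ (hat σ) ⟨$⟩ʳ suc i
Ψ-letter {n} σ i = begin
  inject₁ (Ψ σ ⟨$⟩ʳ i)                              ≡⟨ punchIn-fromℕ (Ψ σ ⟨$⟩ʳ i) ⟨
  punchIn (fromℕ n) (Ψ σ ⟨$⟩ʳ i)                    ≡⟨ cong (λ a → punchIn a (Ψ σ ⟨$⟩ʳ i)) (Φ-hat-zero σ) ⟨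
  punchIn (Φ (hat σ) ⟨$⟩ʳ zero) (Ψ σ ⟨$⟩ʳ i)        ≡⟨ punchIn-permute (Φ (hat σ)) zero i ⟨
  Φ (hat σ) ⟨$⟩ʳ suc i                              ∎
  where open ≡-Reasoning

Ψ-cong : {σ σ′ : Permutation′ n} → σ ≈ σ′ → Ψ σ ≈ Ψ σ′
Ψ-cong {n} {σ} {σ′} σ≈ i = inject₁-injective (begin
  inject₁ (Ψ σ ⟨$⟩ʳ i)      ≡⟨ Ψ-letter σ i ⟩
  Φ (hat σ) ⟨$⟩ʳ suc i      ≡⟨ Φ-cong {ρ = hat σ} {hat σ′} hat≈ (suc i) ⟩
  Φ (hat σ′) ⟨$⟩ʳ suc i     ≡⟨ Ψ-letter σ′ i ⟨
  inject₁ (Ψ σ′ ⟨$⟩ʳ i)     ∎)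
  where
  open ≡-Reasoning
  hat≈ : hat σ ≈ hat σ′
  hat≈ k with fromℕ n ≟ k
  ... | yes _ = refl
  ... | no ≢  = cong suc (σ≈ _)

{-# OPTIONS --safe #-}
module Submission where

-- In a word avoiding 213 that ends with its smallest letter, the letters to the right of x that
-- exceed x precede those below x.  Hence no descent top is crossed, every other letter is
-- crossed at most once, and τ = Φ(ρ) is the only permutation starting with its largest letter
-- that maps the descent tops increasingly onto the descent bottoms, and the other letters but
-- the smallest increasingly onto the rest.  So Ψ(σ) is a union of two increasing words.
-- Moreover x is a descent top exactly when τ(x) < x, so that τ determines the descent tops and
-- the descent bottoms, and these determine a 213-avoiding word letter by letter from its right end.
-- Conversely, a 321-avoiding word increases on its deficiencies and on its excedances; the
-- 213-avoiding word with the corresponding descent tops and bottoms is built by inserting the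
-- letters in increasing order, each into the rightmost of a number of open slots.
open import Defs
open import Data.Empty using (⊥-elim)
open import Data.Fin.Base
  using (Fin; zero; suc; toℕ; fromℕ; fromℕ<; inject₁; cast; opposite; punchIn; punchOut; _<_; _≤_; _>_)
open import Data.Fin.Induction using (<-wellFounded; >-wellFounded; <-weakInduction)
open import Data.Fin.Patterns using (0F; 1F; 2F)
open import Data.Fin.Permutation
  using (Permutation′; _⟨$⟩ʳ_; _⟨$⟩ˡ_; _≈_; _∘ₚ_; inverseˡ; inverseʳ; id; flip; cast-id; reverse;
         insert; remove; insert-remove)
open import Data.Fin.Properties
  using (_≟_; _<?_; _≤?_; any?; <-cmp; <-irrefl; <-asym; ≤∧≢⇒<; ≤fromℕ; suc-injective;
         toℕ-injective; toℕ<n; toℕ-fromℕ; toℕ-fromℕ<; toℕ-inject₁; inject₁-injective;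
         punchOut-injective; injective⇒≤; injective⇒existsPivot; opposite-prop; cast-involutive)
open import Data.Fin.Relation.Unary.Top using (View; view; ‵fromℕ; ‵inject₁)
open import Data.List.Base
  using (List; []; _∷_; _++_; length; map; filter; allFin; lookup; tabulate; replicate; applyDownFrom)
open import Data.List.Membership.Propositional using (_∈_; _∉_)
open import Data.List.Membership.Propositional.Properties
  using (∈-∃++; ∈-insert; ∈-filter⁺; ∈-filter⁻; ∈-allFin; ∈-tabulate⁺; ∈-map⁺; ∈-map⁻;
         ∈-++⁺ˡ; ∈-++⁺ʳ; ∈-++⁻; ∈-applyDownFrom⁺; ∈-applyDownFrom⁻)
open import Data.List.Membership.Propositional.Properties.WithK using (unique∧set⇒bag)
open import Data.List.Properties
  using (length-map; length-tabulate; lookup-tabulate; tabulate-cong; map-tabulate; ++-assoc;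
         filter-++; filter-none; filter-accept; filter-reject; applyDownFrom-∷ʳ; ∷-injective)
open import Data.List.Relation.Binary.BagAndSetEquality using (∼bag⇒↭)
open import Data.List.Relation.Binary.Permutation.Propositional
  using (_↭_; ↭-refl; ↭-reflexive; ↭-sym; ↭-trans; ↭-prep; ↭-swap; ↭⇒↭ₛ; module PermutationReasoning)
open import Data.List.Relation.Binary.Permutation.Propositional.Properties
  using (∈-resp-↭; All-resp-↭; ↭-length; ↭-map-inv; shift; shifts; drop-mid; ++⁺; ∷↭∷ʳ)
open import Data.List.Relation.Binary.Permutation.Setoid using (onIndices)
open import Data.List.Relation.Binary.Permutation.Setoid.Properties using (onIndices-lookup)
open import Data.List.Relation.Binary.Pointwise using (Pointwise; []; _∷_)
open import Data.List.Relation.Unary.All as All using (All; []; _∷_)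
import Data.List.Relation.Unary.All.Properties as All
open import Data.List.Relation.Unary.AllPairs using (AllPairs; []; _∷_)
import Data.List.Relation.Unary.AllPairs.Properties as AllPairs
open import Data.List.Relation.Unary.Any using (here; there)
import Data.List.Relation.Unary.Unique.Propositional.Properties as Unique
open import Data.Nat.Base as ℕ using (ℕ; zero; suc; z≤n; s≤s; _≥_)
import Data.Nat.Properties as ℕ
open import Data.Product.Base using (Σ-syntax; ∃-syntax; _×_; _,_; proj₁; proj₂)
open import Data.Sum.Base using (_⊎_; inj₁; inj₂)
open import Data.Unit.Base using (⊤; tt)
open import Data.Vec.Base as Vec using ([]; _∷_)
open import Function.Base using (_∘_; _on_)
open import Function.Bundles using (_⇔_; mk⇔; Equivalence; Injection)
open import Function.Definitions using (Bijective)
open import Function.Properties.Inverse using (↔⇒↣)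
open import Induction.WellFounded using (Acc; acc)
open import Level using (0ℓ)
open import Relation.Binary.Definitions using (tri<; tri≈; tri>)
open import Relation.Binary.PropositionalEquality
  using (_≡_; _≢_; refl; sym; trans; cong; cong₂; subst; subst₂; ≢-sym; setoid; module ≡-Reasoning)
open import Relation.Nullary using (¬_; Dec; yes; no; ¬?; contradiction)
open import Relation.Nullary.Decidable using (_×-dec_)
open import Relation.Unary using (Pred; Decidable)

private
  variable
    k m n : ℕ
    A B : Set

-- Pigeonhole principles and list lemmas.

≮∧≢⇒> : {x y : Fin m} → ¬ x < y → x ≢ y → y < x
≮∧≢⇒> x≮y x≢y = ≤∧≢⇒< (ℕ.≮⇒≥ x≮y) (≢-sym x≢y)

perm-injective : (π : Permutation′ m) {x y : Fin m} → π ⟨$⟩ʳ x ≡ π ⟨$⟩ʳ y → x ≡ y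
perm-injective π = Injection.injective (↔⇒↣ π)

not-injective : (h : Fin m → Fin m) (t : Fin m) → (∀ x → h x ≢ t) →
                ¬ (∀ {x y} → h x ≡ h y → x ≡ y)
not-injective {suc m} h t ≢t inj =
  ℕ.1+n≰n (injective⇒≤ {f = λ x → punchOut (≢-sym (≢t x))}
    (λ {x} {y} eq → inj (punchOut-injective (≢-sym (≢t x)) (≢-sym (≢t y)) eq)))

-- Extending `h` by the identity outside `P` gives an injective self-map of `Fin m` that misses `t`.
-- This pigeonhole principle underlies the later comparisons of letters with their images.
no-proper-self-injection :
  {P : Pred (Fin m) 0ℓ} (P? : Decidable P) (h : Fin m → Fin m) (t : Fin m) → P t →
  (∀ {x} → P x → P (h x) × h x ≢ t) →
  ¬ (∀ {x y} → P x → P y → h x ≡ h y → x ≡ y)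
no-proper-self-injection {m} {P} P? h t Pt closed inj =
  not-injective (λ x → h′ (P? x)) t (λ x → misses (P? x)) (λ {x} {y} → h′-injective (P? x) (P? y))
  where
  h′ : ∀ {x} → Dec (P x) → Fin m
  h′ {x} (yes _) = h x
  h′ {x} (no _)  = x
  misses : ∀ {x} (d : Dec (P x)) → h′ d ≢ t
  misses (yes p) = proj₂ (closed p)
  misses (no ¬p) refl = ¬p Pt
  h′-injective : ∀ {x y} (d : Dec (P x)) (e : Dec (P y)) → h′ d ≡ h′ e → x ≡ y
  h′-injective (yes p) (yes q) eq = inj p q eq
  h′-injective (yes p) (no ¬q) eq = contradiction (subst P eq (proj₁ (closed p))) ¬q
  h′-injective (no ¬p) (yes q) eq = contradiction (subst P (sym eq) (proj₁ (closed q))) ¬p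
  h′-injective (no _)  (no _)  eq = eq

-- Discrete intermediate value principle: on the way from `zero` to `k` the property must be lost at
-- some step.
crossing-step : {P : Pred (Fin (suc n)) 0ℓ} → Decidable P → P zero → ∀ k → ¬ P k →
                ∃[ i ] P (inject₁ i) × ¬ P (suc i)
crossing-step P? p₀ zero ¬pₖ = contradiction p₀ ¬pₖ
crossing-step {suc n} P? p₀ (suc k) ¬pₖ with P? (suc zero)
... | no ¬p₁ = zero , p₀ , ¬p₁
... | yes p₁ =
  let i , p , ¬p = crossing-step (P? ∘ suc) p₁ k ¬pₖ in suc i , p , ¬p

two-members : {x y : A} {xs : List A} → x ∈ xs → y ∈ xs → x ≢ y → 2 ℕ.≤ length xs
two-members (here refl) (here refl) x≢y = contradiction refl x≢y
two-members {xs = _ ∷ _ ∷ _} _ _ _ = s≤s (s≤s z≤n)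
two-members {xs = _ ∷ []} (here _) (there ()) _
two-members {xs = _ ∷ []} (there ()) _ _

two-distinct : {xs : List A} → AllPairs _≢_ xs → 2 ℕ.≤ length xs →
               ∃[ x ] ∃[ y ] x ∈ xs × y ∈ xs × x ≢ y
two-distinct {xs = x ∷ y ∷ _} ((x≢y ∷ _) ∷ _) _ = x , y , here refl , there (here refl) , x≢y
two-distinct {xs = _ ∷ []} _ (s≤s ())

member : {xs : List A} → 1 ℕ.≤ length xs → ∃[ x ] x ∈ xs
member {xs = x ∷ _} _ = x , here refl

∈⇒1≤length : {x : A} {xs : List A} → x ∈ xs → 1 ℕ.≤ length xs
∈⇒1≤length (here _)  = s≤s z≤n
∈⇒1≤length (there _) = s≤s z≤n

AllPairs-++∷ : {R : A → A → Set} (ys : List A) {x : A} {zs : List A} → AllPairs R (ys ++ x ∷ zs) →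
               All (λ y → R y x) ys × All (R x) zs
AllPairs-++∷ [] (r ∷ _) = [] , r
AllPairs-++∷ (y ∷ ys) (r ∷ rs) =
  let l , r′ = AllPairs-++∷ ys rs
  in All.lookup r (∈-insert ys) ∷ l , r′

Pointwise-++⁻ : {R : A → B → Set} (as : List A) (bs : List B) {as′ : List A} {bs′ : List B} →
                length as ≡ length bs → Pointwise R (as ++ as′) (bs ++ bs′) →
                Pointwise R as bs × Pointwise R as′ bs′
Pointwise-++⁻ [] [] _ rs = [] , rs
Pointwise-++⁻ (a ∷ as) (b ∷ bs) eq (r ∷ rs) =
  let l , r′ = Pointwise-++⁻ as bs (ℕ.suc-injective eq) rs in r ∷ l , r′

Pointwise⇒map : {f : B → A} {as : List A} {bs : List B} → Pointwise (λ a b → f b ≡ a) as bs → map f bs ≡ as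
Pointwise⇒map []       = refl
Pointwise⇒map (e ∷ es) = cong₂ _∷_ e (Pointwise⇒map es)

allFin-increasing : AllPairs _<_ (allFin m)
allFin-increasing = AllPairs.tabulate⁺-< (λ p → p)

-- Cyclic successors in words ending with their smallest letter.

rotation : ∀ n → Permutation′ (suc n)
rotation n = hat (id {n})

-- The words ρ(0) ⋯ ρ(n) that end with their smallest letter, as hat σ does.  Reading such a
-- word cyclically makes the descents exactly the letters x with next x < x.
module EndsInZero {n} (ρ : Permutation′ (suc n)) (last : ρ ⟨$⟩ʳ fromℕ n ≡ zero) where

  -- The cyclic successor of a letter: the rotation of positions conjugated by `ρ`, so that the
  -- final letter is followed by the first.
  next : Permutation′ (suc n)
  next = flip ρ ∘ₚ rotation n ∘ₚ ρ

  next-inject₁ : ∀ i → next ⟨$⟩ʳ (ρ ⟨$⟩ʳ inject₁ i) ≡ ρ ⟨$⟩ʳ suc i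
  next-inject₁ i = cong (ρ ⟨$⟩ʳ_) (trans (cong (rotation n ⟨$⟩ʳ_) (inverseˡ ρ)) (hat-inject₁ id i))

  next-zero : next ⟨$⟩ʳ zero ≡ ρ ⟨$⟩ʳ zero
  next-zero = cong (ρ ⟨$⟩ʳ_) (trans (cong (rotation n ⟨$⟩ʳ_) pos) (hat-fromℕ id))
    where
    pos : ρ ⟨$⟩ˡ zero ≡ fromℕ n
    pos = trans (cong (ρ ⟨$⟩ˡ_) (sym last)) (inverseˡ ρ)

  inject₁≢0 : ∀ i → ρ ⟨$⟩ʳ inject₁ i ≢ zero
  inject₁≢0 i eq with toℕ-inj ← cong toℕ (perm-injective ρ (trans eq (sym last))) =
    ℕ.<⇒≢ (subst (ℕ._< n) (sym (toℕ-inject₁ i)) (toℕ<n i)) (trans toℕ-inj (toℕ-fromℕ n))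

  Consecutive-inject₁ : ∀ (i : Fin n) {j : Fin (suc n)} → Consecutive (inject₁ i) j → j ≡ suc i
  Consecutive-inject₁ i eq = toℕ-injective (trans eq (cong suc (toℕ-inject₁ i)))

  consecutive-suc : ∀ (i : Fin n) → Consecutive (inject₁ i) (suc i)
  consecutive-suc i = cong suc (sym (toℕ-inject₁ i))

  -- View of a letter by its position: the final `zero`, or a letter with a genuine successor in the
  -- word.
  data Letter : Fin (suc n) → Set where
    final : Letter zero
    other : ∀ i → Letter (ρ ⟨$⟩ʳ inject₁ i)

  letterAt : ∀ j → Letter (ρ ⟨$⟩ʳ j)
  letterAt j with view j
  ... | ‵fromℕ     = subst Letter (sym last) final
  ... | ‵inject₁ i = other i

  letter : ∀ x → Letter x
  letter x = subst Letter (inverseʳ ρ) (letterAt (ρ ⟨$⟩ˡ x))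

  top⇒ : ∀ {x} → DescentTop ρ x → next ⟨$⟩ʳ x < x
  top⇒ {x} top with letter x
  top⇒ (_ , _ , ()) | final
  top⇒ (j , eq , lt) | other i
    with refl ← Consecutive-inject₁ i {j} (trans eq (cong (suc ∘ toℕ) (inverseˡ ρ))) =
    subst (_< ρ ⟨$⟩ʳ inject₁ i) (sym (next-inject₁ i)) lt

  ⇒top : ∀ {x} → next ⟨$⟩ʳ x < x → DescentTop ρ x
  ⇒top {x} lt with letter x
  ⇒top () | final
  ... | other i = suc i , trans (consecutive-suc i) (cong (suc ∘ toℕ) (sym (inverseˡ ρ)))
                , subst (_< ρ ⟨$⟩ʳ inject₁ i) (next-inject₁ i) lt

  bottom⇒ : ∀ {x} → DescentBottom ρ (next ⟨$⟩ʳ x) → next ⟨$⟩ʳ x < x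
  bottom⇒ {x} (k , eq , lt) with letter x
  -- The successor of the final letter is the first letter of the word, which has no predecessor and
  -- is thus no descent bottom.
  ... | final = contradiction
    (trans (sym (cong toℕ (trans (cong (ρ ⟨$⟩ˡ_) next-zero) (inverseˡ ρ)))) eq) λ ()
  ... | other i
    with refl ← toℕ-injective {i = k} {inject₁ i} (ℕ.suc-injective (trans (sym eq)
           (trans (cong toℕ (trans (cong (ρ ⟨$⟩ˡ_) (next-inject₁ i)) (inverseˡ ρ))) (consecutive-suc i)))) = lt

  ⇒bottom : ∀ {x} → next ⟨$⟩ʳ x < x → DescentBottom ρ (next ⟨$⟩ʳ x)
  ⇒bottom {x} lt with letter x
  ⇒bottom () | final
  ... | other i = inject₁ i
    , trans (cong toℕ (trans (cong (ρ ⟨$⟩ˡ_) (next-inject₁ i)) (inverseˡ ρ))) (consecutive-suc i) , lt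

  top⇒bottom : ∀ {x} → DescentTop ρ x → DescentBottom ρ (next ⟨$⟩ʳ x)
  top⇒bottom = ⇒bottom ∘ top⇒

  bottom⇒top : ∀ {x} → DescentBottom ρ (next ⟨$⟩ʳ x) → DescentTop ρ x
  bottom⇒top = ⇒top ∘ bottom⇒

  zero-notTop : ¬ DescentTop ρ zero
  zero-notTop (_ , _ , ())

  -- There are as many tops as bottoms, so both rows of the array split at the same column.
  next-tops : map (next ⟨$⟩ʳ_) (descentTops ρ) ↭ descentBottoms ρ
  next-tops = ∼bag⇒↭ (unique∧set⇒bag
    (Unique.map⁺ (perm-injective next) (Unique.filter⁺ (descentTop? ρ) (Unique.allFin⁺ (suc n))))
    (Unique.filter⁺ (descentBottom? ρ) (Unique.allFin⁺ (suc n)))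
    (mk⇔ to from))
    where
    to : ∀ {y} → y ∈ map (next ⟨$⟩ʳ_) (descentTops ρ) → y ∈ descentBottoms ρ
    to y∈ with x , x∈ , refl ← ∈-map⁻ (next ⟨$⟩ʳ_) y∈ =
      ∈-filter⁺ (descentBottom? ρ) (∈-allFin _)
        (top⇒bottom (proj₂ (∈-filter⁻ (descentTop? ρ) {xs = allFin (suc n)} x∈)))
    from : ∀ {y} → y ∈ descentBottoms ρ → y ∈ map (next ⟨$⟩ʳ_) (descentTops ρ)
    from {y} y∈ = subst (_∈ map (next ⟨$⟩ʳ_) (descentTops ρ)) (inverseʳ next)
      (∈-map⁺ (next ⟨$⟩ʳ_) (∈-filter⁺ (descentTop? ρ) (∈-allFin _)
        (bottom⇒top (subst (DescentBottom ρ) (sym (inverseʳ next))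
          (proj₂ (∈-filter⁻ (descentBottom? ρ) {xs = allFin (suc n)} y∈))))))

  module Image {τ : Permutation′ (suc n)} (isΦ : IsΦ ρ τ) where
    open IsΦ isΦ

    split-columns : Pointwise (λ a b → τ ⟨$⟩ʳ b ≡ a) (descentBottoms ρ) f′ ×
                    Pointwise (λ a b → τ ⟨$⟩ʳ b ≡ a) (nondescentBottoms ρ) g′
    split-columns = Pointwise-++⁻ (descentBottoms ρ) f′
      (trans (sym (↭-length next-tops)) (trans (length-map (next ⟨$⟩ʳ_) (descentTops ρ)) (sym (↭-length f′-letters))))
      columns

    f′-image : map (τ ⟨$⟩ʳ_) f′ ≡ descentBottoms ρ
    f′-image = Pointwise⇒map (proj₁ split-columns)

    g′-image : map (τ ⟨$⟩ʳ_) g′ ≡ nondescentBottoms ρ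
    g′-image = Pointwise⇒map (proj₂ split-columns)

    ∈f′ : ∀ {x} → DescentTop ρ x → x ∈ f′
    ∈f′ top = ∈-resp-↭ (↭-sym f′-letters) (∈-filter⁺ (descentTop? ρ) (∈-allFin _) top)

    ∈g′ : ∀ {x} → ¬ DescentTop ρ x → x ∈ g′
    ∈g′ ¬top = ∈-resp-↭ (↭-sym g′-letters) (∈-filter⁺ (¬? ∘ descentTop? ρ) (∈-allFin _) ¬top)

    image-top : ∀ {x} → DescentTop ρ x → DescentBottom ρ (τ ⟨$⟩ʳ x)
    image-top top = proj₂ (∈-filter⁻ (descentBottom? ρ) {xs = allFin (suc n)}
      (subst (_ ∈_) f′-image (∈-map⁺ (τ ⟨$⟩ʳ_) (∈f′ top))))

    image-bottom : ∀ {x} → DescentBottom ρ (τ ⟨$⟩ʳ x) → DescentTop ρ x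
    image-bottom {x} bottom with descentTop? ρ x
    ... | yes top = top
    ... | no ¬top = contradiction bottom (proj₂ (∈-filter⁻ (¬? ∘ descentBottom? ρ) {xs = allFin (suc n)}
      (subst (_ ∈_) g′-image (∈-map⁺ (τ ⟨$⟩ʳ_) (∈g′ ¬top)))))

    f′-sorted : AllPairs (λ x y → τ ⟨$⟩ʳ x < τ ⟨$⟩ʳ y) f′
    f′-sorted = AllPairs.map⁻ (subst (AllPairs _<_) (sym f′-image)
      (AllPairs.filter⁺ (descentBottom? ρ) allFin-increasing))

    g′-sorted : AllPairs (λ x y → τ ⟨$⟩ʳ x < τ ⟨$⟩ʳ y) g′
    g′-sorted = AllPairs.map⁻ (subst (AllPairs _<_) (sym g′-image)
      (AllPairs.filter⁺ (¬? ∘ descentBottom? ρ) allFin-increasing))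

    module _ {w} (sorted : AllPairs (λ x y → τ ⟨$⟩ʳ x < τ ⟨$⟩ʳ y) w) where

      before : ∀ ys {x zs y} → w ≡ ys ++ x ∷ zs → y ∈ w → τ ⟨$⟩ʳ y < τ ⟨$⟩ʳ x → y ∈ ys
      before ys refl y∈ lt with ∈-++⁻ ys y∈
      ... | inj₁ y∈ys = y∈ys
      ... | inj₂ (here refl) = contradiction lt (<-irrefl refl)
      ... | inj₂ (there y∈zs) = contradiction lt (<-asym (All.lookup (proj₂ (AllPairs-++∷ ys sorted)) y∈zs))

      after : ∀ ys {x zs y} → w ≡ ys ++ x ∷ zs → y ∈ w → τ ⟨$⟩ʳ x < τ ⟨$⟩ʳ y → y ∈ zs
      after ys refl y∈ lt with ∈-++⁻ ys y∈
      ... | inj₁ y∈ys = contradiction lt (<-asym (All.lookup (proj₁ (AllPairs-++∷ ys sorted)) y∈ys))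
      ... | inj₂ (here refl) = contradiction lt (<-irrefl refl)
      ... | inj₂ (there y∈zs) = y∈zs

    -- `τ` increases along `f′`, so `y` stands to the left of `x` there and is counted by the code
    -- of `x`.
    inversion-of-tops : ∀ {x y} → DescentTop ρ x → DescentTop ρ y →
                        x < y → τ ⟨$⟩ʳ y < τ ⟨$⟩ʳ x → 1 ℕ.≤ crossings ρ x
    inversion-of-tops {x} top-x top-y x<y lt with ys , zs , eq ← ∈-∃++ (∈f′ top-x) =
      subst (1 ℕ.≤_) (f′-code ys x zs eq)
        (∈⇒1≤length (∈-filter⁺ (x <?_) (before f′-sorted ys eq (∈f′ top-y) lt) x<y))

    -- Both `x₁` and `x₂` stand to the right of `y` in `g′`, where the code of `y` counts them.
    two-inversions-of-nontops : ∀ {x₁ x₂ y} → ¬ DescentTop ρ x₁ → ¬ DescentTop ρ x₂ → ¬ DescentTop ρ y →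
                                x₁ ≢ x₂ → x₁ < y → x₂ < y →
                                τ ⟨$⟩ʳ y < τ ⟨$⟩ʳ x₁ → τ ⟨$⟩ʳ y < τ ⟨$⟩ʳ x₂ → 2 ℕ.≤ crossings ρ y
    two-inversions-of-nontops {y = y} nt₁ nt₂ nt x₁≢x₂ x₁<y x₂<y lt₁ lt₂
      with ys , zs , eq ← ∈-∃++ (∈g′ nt) =
      subst (2 ℕ.≤_) (g′-code ys y zs eq)
        (two-members (∈-filter⁺ (_<? y) (after g′-sorted ys eq (∈g′ nt₁) lt₁) x₁<y)
                     (∈-filter⁺ (_<? y) (after g′-sorted ys eq (∈g′ nt₂) lt₂) x₂<y) x₁≢x₂)

-- Crossing numbers in 213-avoiding words.

Avoids213 : Permutation′ m → Set
Avoids213 ρ = ∀ {i j k} → i < j → j < k → ρ ⟨$⟩ʳ j < ρ ⟨$⟩ʳ i → ¬ ρ ⟨$⟩ʳ i < ρ ⟨$⟩ʳ k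

consecutive-≤ : {i j k : Fin m} → Consecutive i j → i < k → j ≤ k
consecutive-≤ eq i<k = subst (ℕ._≤ _) (sym eq) i<k

module _ (ρ : Permutation′ m) (avoids : Avoids213 ρ) where

  private
    crossing? : ∀ x → Decidable (λ j → (ρ ⟨$⟩ˡ x) < j × CrossedAt ρ x j)
    crossing? x j = ((ρ ⟨$⟩ˡ x) <? j) ×-dec crossedAt? ρ x j

    ∈-crossing : ∀ {x j} → j ∈ filter (crossing? x) (allFin m) → (ρ ⟨$⟩ˡ x) < j × CrossedAt ρ x j
    ∈-crossing {x} j∈ = proj₂ (∈-filter⁻ (crossing? x) {xs = allFin m} j∈)

    smaller-then-larger : ∀ {x j k} → (ρ ⟨$⟩ˡ x) < j → j < k → ρ ⟨$⟩ʳ j < x → ¬ x < ρ ⟨$⟩ʳ k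
    smaller-then-larger {x} {j} {k} x<j j<k lt gt = avoids x<j j<k
      (subst (ρ ⟨$⟩ʳ j <_) (sym (inverseʳ ρ)) lt) (subst (_< ρ ⟨$⟩ʳ k) (sym (inverseʳ ρ)) gt)

    smaller-then-larger-≤ : ∀ {x j k} → (ρ ⟨$⟩ˡ x) < j → j ≤ k → ρ ⟨$⟩ʳ j < x → ¬ x < ρ ⟨$⟩ʳ k
    smaller-then-larger-≤ {x} {j} {k} x<j j≤k lt gt with j ≟ k
    ... | yes refl = <-asym lt gt
    ... | no j≢k   = smaller-then-larger x<j (≤∧≢⇒< j≤k j≢k) lt gt

  -- The letter after `x` is already below `x`; a later crossing would supply a letter above `x` and
  -- complete a 213.
  descentTop-uncrossed : ∀ {x} → DescentTop ρ x → crossings ρ x ℕ.< 1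
  descentTop-uncrossed {x} (j , eq , lt) = ℕ.≰⇒> λ 1≤ →
    let k , k∈ = member 1≤
        x<k , _ , _ , _ , gt = ∈-crossing k∈
    in smaller-then-larger-≤ (ℕ.≤-reflexive (sym eq)) (consecutive-≤ {i = ρ ⟨$⟩ˡ x} {j} eq x<k) lt gt

  -- After a first crossing the word has dropped below `x`; the upper letter of a second one would
  -- complete a 213 begun by `x`.
  crossings≤1 : ∀ x → crossings ρ x ℕ.< 2
  crossings≤1 x = ℕ.≰⇒> λ 2≤ →
    let j , k , j∈ , k∈ , j≢k = two-distinct (Unique.filter⁺ (crossing? x) (Unique.allFin⁺ m)) 2≤
    in absurd j≢k (∈-crossing j∈) (∈-crossing k∈)
    where
    ordered : ∀ {j k} → j < k → (ρ ⟨$⟩ˡ x) < j × CrossedAt ρ x j → ¬ CrossedAt ρ x k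
    ordered {j} j<k (x<j , j′ , eq , lt , _) (_ , _ , _ , gt) =
      smaller-then-larger-≤ (ℕ.<-trans x<j (ℕ.≤-reflexive (sym eq))) (consecutive-≤ {i = j} {j′} eq j<k) lt gt
    absurd : ∀ {j k} → j ≢ k → (ρ ⟨$⟩ˡ x) < j × CrossedAt ρ x j → ¬ ((ρ ⟨$⟩ˡ x) < k × CrossedAt ρ x k)
    absurd {j} {k} j≢k p q with <-cmp j k
    ... | tri< j<k _ _ = ordered j<k p (proj₂ q)
    ... | tri≈ _ j≡k _ = j≢k j≡k
    ... | tri> _ _ k<j = ordered k<j q (proj₂ p)

-- Pattern containment as inequalities between letters.

module _ (σ : Permutation′ m) (π : Permutation′ k) (p : Fin k → Fin m) where

  occurrence : (∀ {a b} → a < b → p a < p b) →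
               (∀ a b → π ⟨$⟩ʳ a < π ⟨$⟩ʳ b → σ ⟨$⟩ʳ p a < σ ⟨$⟩ʳ p b) → σ Contains π
  occurrence p-mono mono = p , p-mono , λ a b → mk⇔ (reflects a b) (mono a b)
    where
    reflects : ∀ a b → σ ⟨$⟩ʳ p a < σ ⟨$⟩ʳ p b → π ⟨$⟩ʳ a < π ⟨$⟩ʳ b
    reflects a b lt with <-cmp (π ⟨$⟩ʳ a) (π ⟨$⟩ʳ b)
    ... | tri< πa<πb _ _ = πa<πb
    ... | tri≈ _ eq _    = contradiction (cong (λ c → σ ⟨$⟩ʳ p c) (perm-injective π eq)) (ℕ.<⇒≢ lt ∘ cong toℕ)
    ... | tri> _ _ πb<πa = contradiction lt (<-asym (mono b a πb<πa))

triple : (i j k : Fin m) → Fin 3 → Fin m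
triple i j k = Vec.lookup (i ∷ j ∷ k ∷ [])

triple-increasing : {i j k : Fin m} → i < j → j < k → ∀ {a b} → a < b → triple i j k a < triple i j k b
triple-increasing i<j j<k {0F} {0F} ()
triple-increasing i<j j<k {0F} {1F} _ = i<j
triple-increasing i<j j<k {0F} {2F} _ = ℕ.<-trans i<j j<k
triple-increasing i<j j<k {1F} {0F} ()
triple-increasing i<j j<k {1F} {1F} (s≤s ())
triple-increasing i<j j<k {1F} {2F} _ = j<k
triple-increasing i<j j<k {2F} {0F} ()
triple-increasing i<j j<k {2F} {1F} (s≤s ())
triple-increasing i<j j<k {2F} {2F} (s≤s (s≤s ()))

module _ (σ : Permutation′ m) where

  avoids-213 : σ Avoids [213] → Avoids213 σ
  avoids-213 avoids {i} {j} {k} i<j j<k σj<σi σi<σk =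
    avoids (occurrence σ [213] (triple i j k) (triple-increasing i<j j<k) mono)
    where
    mono : ∀ a b → [213] ⟨$⟩ʳ a < [213] ⟨$⟩ʳ b → σ ⟨$⟩ʳ triple i j k a < σ ⟨$⟩ʳ triple i j k b
    mono 0F 0F (s≤s ())
    mono 0F 1F ()
    mono 0F 2F _ = σi<σk
    mono 1F 0F _ = σj<σi
    mono 1F 1F ()
    mono 1F 2F _ = ℕ.<-trans σj<σi σi<σk
    mono 2F 0F (s≤s ())
    mono 2F 1F ()
    mono 2F 2F (s≤s (s≤s ()))

  213-avoiding : Avoids213 σ → σ Avoids [213]
  213-avoiding avoids (p , p-mono , iso) =
    avoids (p-mono {0F} {1F} (s≤s z≤n)) (p-mono {1F} {2F} (s≤s (s≤s z≤n)))
      (Equivalence.from (iso 1F 0F) (s≤s z≤n)) (Equivalence.from (iso 0F 2F) (s≤s (s≤s z≤n)))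

  avoids-321 : σ Avoids [321] → ∀ {i j k} → i < j → j < k → σ ⟨$⟩ʳ j < σ ⟨$⟩ʳ i → ¬ σ ⟨$⟩ʳ k < σ ⟨$⟩ʳ j
  avoids-321 avoids {i} {j} {k} i<j j<k σj<σi σk<σj =
    avoids (occurrence σ [321] (triple i j k) (triple-increasing i<j j<k) mono)
    where
    mono : ∀ a b → [321] ⟨$⟩ʳ a < [321] ⟨$⟩ʳ b → σ ⟨$⟩ʳ triple i j k a < σ ⟨$⟩ʳ triple i j k b
    mono 0F 0F (s≤s (s≤s ()))
    mono 0F 1F (s≤s ())
    mono 0F 2F ()
    mono 1F 0F _ = σj<σi
    mono 1F 1F (s≤s ())
    mono 1F 2F ()
    mono 2F 0F _ = ℕ.<-trans σk<σj σj<σi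
    mono 2F 1F _ = σk<σj
    mono 2F 2F ()

  321-avoiding : (∀ {i j k} → i < j → j < k → σ ⟨$⟩ʳ j < σ ⟨$⟩ʳ i → ¬ σ ⟨$⟩ʳ k < σ ⟨$⟩ʳ j) → σ Avoids [321]
  321-avoiding avoids (p , p-mono , iso) =
    avoids (p-mono {0F} {1F} (s≤s z≤n)) (p-mono {1F} {2F} (s≤s (s≤s z≤n)))
      (Equivalence.from (iso 1F 0F) (s≤s (s≤s z≤n))) (Equivalence.from (iso 2F 1F) (s≤s z≤n))

inject₁-< : {i j : Fin n} → i < j → inject₁ i < inject₁ j
inject₁-< {i = i} {j} = subst₂ ℕ._<_ (sym (toℕ-inject₁ i)) (sym (toℕ-inject₁ j))

inject₁-<⁻ : {i j : Fin n} → inject₁ i < inject₁ j → i < j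
inject₁-<⁻ {i = i} {j} = subst₂ ℕ._<_ (toℕ-inject₁ i) (toℕ-inject₁ j)

-- The appended letter comes last, so it could only play the 3 of the pattern, and it is the
-- smallest.
hat-avoids-213 : (σ : Permutation′ n) → Avoids213 σ → Avoids213 (hat σ)
hat-avoids-213 {n} σ avoids {i} {j} {k} i<j j<k lt gt = go (view i) (view j) (view k) i<j j<k lt gt
  where
  ρ = hat σ
  top≮ : ∀ {a} → ¬ fromℕ n < a
  top≮ lt = ℕ.<⇒≱ lt (≤fromℕ _)
  go : ∀ {i j k} → View i → View j → View k → i < j → j < k → ρ ⟨$⟩ʳ j < ρ ⟨$⟩ʳ i → ¬ ρ ⟨$⟩ʳ i < ρ ⟨$⟩ʳ k
  go ‵fromℕ _ _ i<j _ _ _ = top≮ i<j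
  go (‵inject₁ i) ‵fromℕ _ _ j<k _ _ = top≮ j<k
  go (‵inject₁ i) (‵inject₁ j) ‵fromℕ _ _ _ gt with () ← subst (ρ ⟨$⟩ʳ inject₁ i <_) (hat-fromℕ σ) gt
  go (‵inject₁ i) (‵inject₁ j) (‵inject₁ k) i<j j<k lt gt = avoids (inject₁-<⁻ i<j) (inject₁-<⁻ j<k)
    (ℕ.s<s⁻¹ (subst₂ _<_ (hat-inject₁ σ j) (hat-inject₁ σ i) lt))
    (ℕ.s<s⁻¹ (subst₂ _<_ (hat-inject₁ σ i) (hat-inject₁ σ k) gt))

hat-avoids-213⁻ : (σ : Permutation′ n) → Avoids213 (hat σ) → Avoids213 σ
hat-avoids-213⁻ σ avoids {i} {j} {k} i<j j<k lt gt = avoids (inject₁-< i<j) (inject₁-< j<k)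
  (subst₂ _<_ (sym (hat-inject₁ σ j)) (sym (hat-inject₁ σ i)) (s≤s lt))
  (subst₂ _<_ (sym (hat-inject₁ σ i)) (sym (hat-inject₁ σ k)) (s≤s gt))

-- Monotonicity and deficiencies of the image under `Φ`.

-- The two classes are `X` and its complement. The letter `zero` is exempt because the permutations
-- considered send it to the largest value.
IncreasingOnClasses : Pred (Fin (suc n)) 0ℓ → Permutation′ (suc n) → Set
IncreasingOnClasses X τ =
  ∀ {a b} → a ≢ zero → (X a → X b) → (X b → X a) → a < b → τ ⟨$⟩ʳ a < τ ⟨$⟩ʳ b

<fromℕ : {a : Fin (suc n)} → a ≢ fromℕ n → a < fromℕ n
<fromℕ = ≤∧≢⇒< (≤fromℕ _)

module _ {n} (ρ τ : Permutation′ (suc n)) (last : ρ ⟨$⟩ʳ fromℕ n ≡ zero) (avoids : Avoids213 ρ)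
         (isΦ : IsΦ ρ τ) (τ-zero : τ ⟨$⟩ʳ zero ≡ fromℕ n) where

  open EndsInZero ρ last
  open Image isΦ

  -- An inverted pair of tops forces a crossing of `a`. An inverted pair of other letters puts both
  -- `a` and `zero` after `b` in `g′`, since `τ` is largest at `zero`, and forces two crossings of
  -- `b`.
  increasing-on-tops : IncreasingOnClasses (DescentTop ρ) τ
  increasing-on-tops {a} {b} a≢0 a⇒b b⇒a a<b with <-cmp (τ ⟨$⟩ʳ a) (τ ⟨$⟩ʳ b)
  ... | tri< lt _ _ = lt
  ... | tri≈ _ eq _ = contradiction (cong toℕ (perm-injective τ eq)) (ℕ.<⇒≢ a<b)
  ... | tri> _ _ gt with descentTop? ρ a
  ...   | yes top = contradiction (descentTop-uncrossed ρ avoids top)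
                      (ℕ.≤⇒≯ (inversion-of-tops top (a⇒b top) a<b gt))
  ...   | no ¬top = contradiction (crossings≤1 ρ avoids b)
                      (ℕ.≤⇒≯ (two-inversions-of-nontops ¬top zero-notTop (¬top ∘ b⇒a) a≢0 a<b 0<b gt τb<τ0))
    where
    0<b : zero {n} < b
    0<b = ℕ.≤-<-trans z≤n a<b
    τb<τ0 : τ ⟨$⟩ʳ b < τ ⟨$⟩ʳ zero
    τb<τ0 = subst (τ ⟨$⟩ʳ b <_) (sym τ-zero)
      (<fromℕ λ eq → ℕ.<⇒≢ 0<b (cong toℕ (perm-injective τ (trans τ-zero (sym eq)))))

  increasing : ∀ {a b} → a ≢ zero → (DescentTop ρ a → DescentTop ρ b) → (DescentTop ρ b → DescentTop ρ a) →
               a ≤ b → τ ⟨$⟩ʳ a ≤ τ ⟨$⟩ʳ b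
  increasing {a} {b} a≢0 a⇒b b⇒a a≤b with a ≟ b
  ... | yes refl = ℕ.≤-refl
  ... | no a≢b   = ℕ.<⇒≤ (increasing-on-tops a≢0 a⇒b b⇒a (≤∧≢⇒< a≤b a≢b))

  top≢0 : ∀ {x} → DescentTop ρ x → x ≢ zero
  top≢0 top refl = zero-notTop top

  -- If `x ≤ τ x`, the map `h` would inject the tops up to `x` into those strictly below `x`: the
  -- value of `τ` at `h s` is `next s`, which is less than `s` and so less than `τ x`.
  descentTop⇒deficiency : ∀ {x} → DescentTop ρ x → τ ⟨$⟩ʳ x < x
  descentTop⇒deficiency {x} top with τ ⟨$⟩ʳ x <? x
  ... | yes lt = lt
  ... | no τx≮x = ⊥-elim (no-proper-self-injection (λ s → descentTop? ρ s ×-dec s ≤? x) h x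
      (top , ℕ.≤-refl) closed (λ _ _ eq → perm-injective next (perm-injective (flip τ) eq)))
    where
    h : Fin (suc n) → Fin (suc n)
    h s = τ ⟨$⟩ˡ (next ⟨$⟩ʳ s)
    closed : ∀ {s} → DescentTop ρ s × s ≤ x → (DescentTop ρ (h s) × h s ≤ x) × h s ≢ x
    closed {s} (top-s , s≤x) = (top-hs , ℕ.<⇒≤ hs<x) , (λ eq → ℕ.<⇒≢ hs<x (cong toℕ eq))
      where
      top-hs : DescentTop ρ (h s)
      top-hs = image-bottom (subst (DescentBottom ρ) (sym (inverseʳ τ)) (top⇒bottom top-s))
      hs<x : h s < x
      hs<x = ℕ.≰⇒> λ x≤hs → ℕ.<-irrefl refl (begin-strict
        toℕ x                      ≤⟨ ℕ.≮⇒≥ τx≮x ⟩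
        toℕ (τ ⟨$⟩ʳ x)             ≤⟨ increasing (top≢0 top) (λ _ → top-hs) (λ _ → top) x≤hs ⟩
        toℕ (τ ⟨$⟩ʳ h s)           ≡⟨ cong toℕ (inverseʳ τ) ⟩
        toℕ (next ⟨$⟩ʳ s)          <⟨ top⇒ top-s ⟩
        toℕ s                      ≤⟨ s≤x ⟩
        toℕ x                      ∎)
        where open ℕ.≤-Reasoning

  -- The word begins below `x` but contains the largest letter, so it ascends from below `x` to `x`
  -- or higher somewhere.
  next-crosses : ∀ x → next ⟨$⟩ʳ zero < x → ∃[ s ] s ≢ zero × s < x × x ≤ next ⟨$⟩ʳ s
  next-crosses x lt =
    let i , below , ¬below = crossing-step (λ j → ρ ⟨$⟩ʳ j <? x) (subst (_< x) next-zero lt) (ρ ⟨$⟩ˡ fromℕ n)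
          (λ below → ℕ.<⇒≱ below (subst (toℕ x ℕ.≤_) (cong toℕ (sym (inverseʳ ρ))) (≤fromℕ x)))
    in ρ ⟨$⟩ʳ inject₁ i , inject₁≢0 i , below
     , subst (x ≤_) (sym (next-inject₁ i)) (ℕ.≮⇒≥ ¬below)

  -- If `τ x < x`, the cyclic predecessors of the values `τ s`, for nonzero nontops `s ≤ x`, are
  -- nontops below `x`, because a nontop is at most its successor. Up to a repair at `zero`, this
  -- injects a finite set into itself while missing `x`.
  nontop⇒exceedance : ∀ {x} → x ≢ zero → ¬ DescentTop ρ x → x ≤ τ ⟨$⟩ʳ x
  nontop⇒exceedance {x} x≢0 ¬top with τ ⟨$⟩ʳ x <? x
  ... | no τx≮x = ℕ.≮⇒≥ τx≮x
  ... | yes τx<x = ⊥-elim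
      (no-proper-self-injection (λ s → ¬? (s ≟ zero) ×-dec (¬? (descentTop? ρ s) ×-dec s ≤? x))
        (λ s → h s (g s ≟ zero)) x (x≢0 , ¬top , ℕ.≤-refl) (λ {s} Ps → closed Ps (g s ≟ zero))
        (λ {s} {t} Ps Pt → h-injective Ps Pt (g s ≟ zero) (g t ≟ zero)))
    where
    -- The cyclic predecessor of τ s is replaced, when it is the final letter of ρ, by a letter
    -- from which ρ ascends across x; that letter is not needed otherwise.
    P : Pred (Fin (suc n)) 0ℓ
    P s = s ≢ zero × ¬ DescentTop ρ s × s ≤ x
    g : Fin (suc n) → Fin (suc n)
    g s = next ⟨$⟩ˡ (τ ⟨$⟩ʳ s)
    s* : Fin (suc n)
    s* with next ⟨$⟩ʳ zero <? x
    ... | yes lt = proj₁ (next-crosses x lt)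
    ... | no _   = x
    s*-crosses : next ⟨$⟩ʳ zero < x → s* ≢ zero × s* < x × x ≤ next ⟨$⟩ʳ s*
    s*-crosses lt with next ⟨$⟩ʳ zero <? x
    ... | yes lt′ = proj₂ (next-crosses x lt′)
    ... | no ≮    = contradiction lt ≮
    h : ∀ s → Dec (g s ≡ zero) → Fin (suc n)
    h s (yes _) = s*
    h s (no _)  = g s
    next-g : ∀ s → next ⟨$⟩ʳ g s ≡ τ ⟨$⟩ʳ s
    next-g s = inverseʳ next
    below : ∀ {s} → P s → τ ⟨$⟩ʳ s < x
    below (s≢0 , ¬top-s , s≤x) = ℕ.≤-<-trans
      (increasing s≢0 (λ top-s → contradiction top-s ¬top-s) (λ top → contradiction top ¬top) s≤x) τx<x
    zero-below : ∀ {s} → P s → g s ≡ zero → next ⟨$⟩ʳ zero < x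
    zero-below {s} Ps eq = subst (_< x) (trans (sym (next-g s)) (cong (next ⟨$⟩ʳ_) eq)) (below Ps)
    closed : ∀ {s} → P s → (d : Dec (g s ≡ zero)) → P (h s d) × h s d ≢ x
    closed Ps (yes eq) =
      let s*≢0 , s*<x , x≤next = s*-crosses (zero-below Ps eq)
      in (s*≢0 , (λ top → ℕ.<-asym (top⇒ top) (ℕ.<-≤-trans s*<x x≤next)) , ℕ.<⇒≤ s*<x)
       , λ eq → ℕ.<⇒≢ s*<x (cong toℕ eq)
    closed {s} Ps@(_ , ¬top-s , _) (no gs≢0) =
      (gs≢0 , ¬top-gs , ℕ.<⇒≤ gs<x) , λ eq → ℕ.<⇒≢ gs<x (cong toℕ eq)
      where
      ¬top-gs : ¬ DescentTop ρ (g s)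
      ¬top-gs top = ¬top-s (image-bottom (subst (DescentBottom ρ) (next-g s) (top⇒bottom top)))
      gs<x : g s < x
      gs<x = ℕ.≤-<-trans (ℕ.≮⇒≥ λ lt → ¬top-gs (⇒top (subst (_< g s) (sym (next-g s)) lt))) (below Ps)
    h-injective : ∀ {s t} → P s → P t → (d : Dec (g s ≡ zero)) (e : Dec (g t ≡ zero)) → h s d ≡ h t e → s ≡ t
    redirected : ∀ {s t} → P s → P t → g s ≡ zero → s* ≢ g t
    redirected {s} {t} Ps Pt gs≡0 eq = ℕ.<⇒≱ (below Pt)
      (subst (x ≤_) (trans (cong (next ⟨$⟩ʳ_) eq) (next-g t)) (proj₂ (proj₂ (s*-crosses (zero-below Ps gs≡0)))))
    h-injective Ps Pt (yes p) (yes q) _ = perm-injective τ (perm-injective (flip next) (trans p (sym q)))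
    h-injective Ps Pt (yes p) (no _) eq = contradiction eq (redirected Ps Pt p)
    h-injective Ps Pt (no _) (yes q) eq = contradiction (sym eq) (redirected Pt Ps q)
    h-injective Ps Pt (no _) (no _) eq = perm-injective τ (perm-injective (flip next) eq)

  deficiency⇒descentTop : ∀ {x} → τ ⟨$⟩ʳ x < x → DescentTop ρ x
  deficiency⇒descentTop {x} lt with descentTop? ρ x
  ... | yes top = top
  ... | no ¬top with x ≟ zero
  deficiency⇒descentTop () | no _ | yes refl
  ... | no x≢0 = contradiction lt (ℕ.≤⇒≯ (nontop⇒exceedance x≢0 ¬top))

-- The image of `Ψ` avoids 321.

<⇒≢zero : {a b : Fin (suc n)} → a < b → b ≢ zero
<⇒≢zero () refl

-- Of three letters two share a class, and in a 321 every two of the three are inverted.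
no-double-inversion : {X : Pred (Fin (suc n)) 0ℓ} → Decidable X → (τ : Permutation′ (suc n)) →
                      IncreasingOnClasses X τ → ∀ {a b c} → a ≢ zero → a < b → b < c →
                      τ ⟨$⟩ʳ b < τ ⟨$⟩ʳ a → ¬ τ ⟨$⟩ʳ c < τ ⟨$⟩ʳ b
no-double-inversion X? τ inc {a} {b} {c} a≢0 a<b b<c τb<τa τc<τb = go (X? a) (X? b) (X? c)
  where
  b≢0 : b ≢ zero
  b≢0 = <⇒≢zero a<b
  ab : ¬ _
  ab (a⇒b , b⇒a) = <-asym τb<τa (inc a≢0 a⇒b b⇒a a<b)
  bc : ¬ _
  bc (b⇒c , c⇒b) = <-asym τc<τb (inc b≢0 b⇒c c⇒b b<c)
  ac : ¬ _
  ac (a⇒c , c⇒a) = <-asym (ℕ.<-trans τc<τb τb<τa) (inc a≢0 a⇒c c⇒a (ℕ.<-trans a<b b<c))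
  go : _ → _ → _ → _
  go (yes p) (yes q) _       = ab ((λ _ → q) , (λ _ → p))
  go (yes p) (no _)  (yes r) = ac ((λ _ → r) , (λ _ → p))
  go (yes _) (no ¬q) (no ¬r) = bc ((λ q → contradiction q ¬q) , (λ r → contradiction r ¬r))
  go (no _)  (yes q) (yes r) = bc ((λ _ → r) , (λ _ → q))
  go (no ¬p) (yes _) (no ¬r) = ac ((λ p → contradiction p ¬p) , (λ r → contradiction r ¬r))
  go (no ¬p) (no ¬q) _       = ab ((λ p → contradiction p ¬p) , (λ q → contradiction q ¬q))

Φ-hat-increasing : (σ : Permutation′ n) → σ Avoids [213] → IncreasingOnClasses (DescentTop (hat σ)) (Φ (hat σ))
Φ-hat-increasing σ avoids = increasing-on-tops (hat σ) (Φ (hat σ)) (hat-fromℕ σ)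
  (hat-avoids-213 σ (avoids-213 σ avoids)) (Φ-isΦ (hat σ)) (Φ-hat-zero σ)

Ψ-avoids-321 : (σ : Permutation′ n) → σ Avoids [213] → Ψ σ Avoids [321]
Ψ-avoids-321 σ avoids = 321-avoiding (Ψ σ) λ i<j j<k lt₁ lt₂ →
  no-double-inversion (descentTop? (hat σ)) (Φ (hat σ)) (Φ-hat-increasing σ avoids)
    (λ ()) (s≤s i<j) (s≤s j<k) (shifted lt₁) (shifted lt₂)
  where
  shifted : ∀ {i j} → Ψ σ ⟨$⟩ʳ i < Ψ σ ⟨$⟩ʳ j → Φ (hat σ) ⟨$⟩ʳ suc i < Φ (hat σ) ⟨$⟩ʳ suc j
  shifted {i} {j} lt = subst₂ _<_ (Ψ-letter σ i) (Ψ-letter σ j) (inject₁-< lt)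

-- Recovery of a word from its descents; injectivity.

position< : (ρ : Permutation′ (suc n)) (i : Fin n) {x : Fin (suc n)} → x ≢ ρ ⟨$⟩ʳ inject₁ i →
            (∀ {j} → inject₁ i < j → x ≢ ρ ⟨$⟩ʳ j) → ρ ⟨$⟩ˡ x < inject₁ i
position< ρ i x≢ later≢ with <-cmp (ρ ⟨$⟩ˡ _) (inject₁ i)
... | tri< lt _ _ = lt
... | tri≈ _ eq _ = contradiction (trans (sym (inverseʳ ρ)) (cong (ρ ⟨$⟩ʳ_) eq)) x≢
... | tri> _ _ gt = contradiction (sym (inverseʳ ρ)) (later≢ gt)

module _ {n} (ρ ρ′ : Permutation′ (suc n)) (avoids : Avoids213 ρ) (avoids′ : Avoids213 ρ′)
         (last : ρ ⟨$⟩ʳ fromℕ n ≡ zero) (last′ : ρ′ ⟨$⟩ʳ fromℕ n ≡ zero)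
         (tops : ∀ {x} → DescentTop ρ x → DescentTop ρ′ x)
         (bottoms : ∀ {x} → DescentBottom ρ′ x → DescentBottom ρ x) where

  private
    module E = EndsInZero ρ last
    module E′ = EndsInZero ρ′ last′

  -- Since all later letters agree, `x′` occurs earlier in `ρ`, and `x` earlier in `ρ′`; the common
  -- next letter `z` is compared with both. The inclusions of tops and bottoms run in opposite
  -- directions, and exchanging the two words excludes the other strict inequality.
  letter≮ : ∀ i → (∀ {j} → inject₁ i < j → ρ ⟨$⟩ʳ j ≡ ρ′ ⟨$⟩ʳ j) →
            ¬ ρ ⟨$⟩ʳ inject₁ i < ρ′ ⟨$⟩ʳ inject₁ i
  letter≮ i agree x<x′ = go (<-cmp z x) (<-cmp z x′)
    where
    x  = ρ ⟨$⟩ʳ inject₁ i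
    x′ = ρ′ ⟨$⟩ʳ inject₁ i
    z  = ρ ⟨$⟩ʳ suc i
    here<next : inject₁ i < suc i
    here<next = s≤s (ℕ.≤-reflexive (toℕ-inject₁ i))
    z≡ : z ≡ ρ′ ⟨$⟩ʳ suc i
    z≡ = agree here<next
    x≢x′ : x ≢ x′
    x≢x′ eq = ℕ.<⇒≢ x<x′ (cong toℕ eq)
    later≢ : ∀ (π : Permutation′ (suc n)) {j} → inject₁ i < j → π ⟨$⟩ʳ inject₁ i ≢ π ⟨$⟩ʳ j
    later≢ π lt eq = ℕ.<⇒≢ lt (cong toℕ (perm-injective π eq))
    x′-before : ρ ⟨$⟩ˡ x′ < inject₁ i
    x′-before = position< ρ i (x≢x′ ∘ sym) λ lt eq → later≢ ρ′ lt (trans eq (agree lt))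
    x-before : ρ′ ⟨$⟩ˡ x < inject₁ i
    x-before = position< ρ′ i x≢x′ λ lt eq → later≢ ρ lt (trans eq (sym (agree lt)))
    top-x : z < x → DescentTop ρ′ x
    top-x z<x = tops (E.⇒top (subst (_< x) (sym (E.next-inject₁ i)) z<x))
    bottom-z : z < x′ → DescentBottom ρ z
    bottom-z z<x′ = bottoms (subst (DescentBottom ρ′) (trans (E′.next-inject₁ i) (sym z≡))
      (E′.⇒bottom (subst (_< x′) (trans z≡ (sym (E′.next-inject₁ i))) z<x′)))
    go : _ → _ → _
    go (tri≈ _ z≡x _) _ = later≢ ρ here<next (sym z≡x)
    go _ (tri≈ _ z≡x′ _) = later≢ ρ′ here<next (trans (sym z≡x′) z≡)
    -- With `z` above both, `x′`, `x`, `z` form a 213 in `ρ`.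
    go (tri> _ _ x<z) (tri> _ _ x′<z) = avoids x′-before here<next
      (subst (x <_) (sym (inverseʳ ρ)) x<x′) (subst (_< z) (sym (inverseʳ ρ)) x′<z)
    -- With `z` between them, `z` is a descent bottom of `ρ′`, hence of `ρ`, where the smaller `x`
    -- precedes it.
    go (tri> _ _ x<z) (tri< z<x′ _ _) = <-asym x<z (subst (_< x) (E.next-inject₁ i)
      (E.bottom⇒ (subst (DescentBottom ρ) (sym (E.next-inject₁ i)) (bottom-z z<x′))))
    -- With `z` below both, `x` is a descent top of `ρ`, hence of `ρ′`; there the descent at `x` and
    -- the later `x′` form a 213.
    go (tri< z<x _ _) _ with j , eq , lt ← top-x z<x =
      avoids′ {ρ′ ⟨$⟩ˡ x} {j} (ℕ.≤-reflexive (sym eq))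
        (≤∧≢⇒< (consecutive-≤ {i = ρ′ ⟨$⟩ˡ x} {j} eq x-before)
          λ { refl → <-asym lt x<x′ })
        (subst (ρ′ ⟨$⟩ʳ j <_) (sym (inverseʳ ρ′)) lt) (subst (_< x′) (sym (inverseʳ ρ′)) x<x′)

module _ {n} (ρ ρ′ : Permutation′ (suc n)) (avoids : Avoids213 ρ) (avoids′ : Avoids213 ρ′)
         (last : ρ ⟨$⟩ʳ fromℕ n ≡ zero) (last′ : ρ′ ⟨$⟩ʳ fromℕ n ≡ zero)
         (tops : ∀ {x} → DescentTop ρ x ⇔ DescentTop ρ′ x)
         (bottoms : ∀ {x} → DescentBottom ρ x ⇔ DescentBottom ρ′ x) where

  open Equivalence

  determined-by-descents : ρ ≈ ρ′
  determined-by-descents i = go i (>-wellFounded i)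
    where
    go : ∀ i → Acc _>_ i → ρ ⟨$⟩ʳ i ≡ ρ′ ⟨$⟩ʳ i
    step : ∀ {i} → View i → (∀ {j} → i < j → ρ ⟨$⟩ʳ j ≡ ρ′ ⟨$⟩ʳ j) → ρ ⟨$⟩ʳ i ≡ ρ′ ⟨$⟩ʳ i
    step ‵fromℕ _ = trans last (sym last′)
    step (‵inject₁ i) agree with <-cmp (ρ ⟨$⟩ʳ inject₁ i) (ρ′ ⟨$⟩ʳ inject₁ i)
    ... | tri≈ _ eq _ = eq
    ... | tri< lt _ _ = ⊥-elim (letter≮ ρ ρ′ avoids avoids′ last last′ (to tops) (from bottoms) i agree lt)
    ... | tri> _ _ gt = ⊥-elim (letter≮ ρ′ ρ avoids′ avoids last′ last (from tops) (to bottoms) i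
                          (λ lt → sym (agree lt)) gt)
    go i (acc rec) = step (view i) λ lt → go _ (rec lt)

module _ {n} (ρ ρ′ τ τ′ : Permutation′ (suc n)) (τ≈ : τ ≈ τ′)
         (last : ρ ⟨$⟩ʳ fromℕ n ≡ zero) (last′ : ρ′ ⟨$⟩ʳ fromℕ n ≡ zero)
         (avoids : Avoids213 ρ) (avoids′ : Avoids213 ρ′) (isΦ : IsΦ ρ τ) (isΦ′ : IsΦ ρ′ τ′)
         (τ-zero : τ ⟨$⟩ʳ zero ≡ fromℕ n) (τ′-zero : τ′ ⟨$⟩ʳ zero ≡ fromℕ n) where

  Φ-determines-tops : ∀ {x} → DescentTop ρ x → DescentTop ρ′ x
  Φ-determines-tops {x} top = deficiency⇒descentTop ρ′ τ′ last′ avoids′ isΦ′ τ′-zero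
    (subst (_< x) (τ≈ x) (descentTop⇒deficiency ρ τ last avoids isΦ τ-zero top))

  Φ-determines-bottoms : ∀ {x} → DescentBottom ρ x → DescentBottom ρ′ x
  Φ-determines-bottoms {x} bottom = subst (DescentBottom ρ′) (trans (sym (τ≈ _)) (inverseʳ τ))
    (I′.image-top (Φ-determines-tops
      (I.image-bottom {τ ⟨$⟩ˡ x} (subst (DescentBottom ρ) (sym (inverseʳ τ)) bottom))))
    where
    module I  = EndsInZero.Image ρ last isΦ
    module I′ = EndsInZero.Image ρ′ last′ isΦ′

Φ-injective : (ρ ρ′ τ τ′ : Permutation′ (suc n)) → τ ≈ τ′ →
              ρ ⟨$⟩ʳ fromℕ n ≡ zero → ρ′ ⟨$⟩ʳ fromℕ n ≡ zero → Avoids213 ρ → Avoids213 ρ′ →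
              IsΦ ρ τ → IsΦ ρ′ τ′ → τ ⟨$⟩ʳ zero ≡ fromℕ n → τ′ ⟨$⟩ʳ zero ≡ fromℕ n → ρ ≈ ρ′
Φ-injective ρ ρ′ τ τ′ τ≈ last last′ avoids avoids′ isΦ isΦ′ τ0 τ′0 =
  determined-by-descents ρ ρ′ avoids avoids′ last last′
    (mk⇔ (Φ-determines-tops ρ ρ′ τ τ′ τ≈ last last′ avoids avoids′ isΦ isΦ′ τ0 τ′0)
         (Φ-determines-tops ρ′ ρ τ′ τ τ≈′ last′ last avoids′ avoids isΦ′ isΦ τ′0 τ0))
    (mk⇔ (Φ-determines-bottoms ρ ρ′ τ τ′ τ≈ last last′ avoids avoids′ isΦ isΦ′ τ0 τ′0)
         (Φ-determines-bottoms ρ′ ρ τ′ τ τ≈′ last′ last avoids′ avoids isΦ′ isΦ τ′0 τ0))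
  where
  τ≈′ : τ′ ≈ τ
  τ≈′ i = sym (τ≈ i)

Ψ-injective : (σ σ′ : Permutation′ n) → σ Avoids [213] → σ′ Avoids [213] → Ψ σ ≈ Ψ σ′ → σ ≈ σ′
Ψ-injective σ σ′ avoids avoids′ Ψ≈ i = suc-injective (begin
  suc (σ ⟨$⟩ʳ i)               ≡⟨ hat-inject₁ σ i ⟨
  hat σ ⟨$⟩ʳ inject₁ i         ≡⟨ hat≈ (inject₁ i) ⟩
  hat σ′ ⟨$⟩ʳ inject₁ i        ≡⟨ hat-inject₁ σ′ i ⟩
  suc (σ′ ⟨$⟩ʳ i)              ∎)
  where
  open ≡-Reasoning
  Φ≈ : Φ (hat σ) ≈ Φ (hat σ′)
  Φ≈ zero    = trans (Φ-hat-zero σ) (sym (Φ-hat-zero σ′))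
  Φ≈ (suc i) = trans (sym (Ψ-letter σ i)) (trans (cong inject₁ (Ψ≈ i)) (Ψ-letter σ′ i))
  hat≈ : hat σ ≈ hat σ′
  hat≈ = Φ-injective (hat σ) (hat σ′) (Φ (hat σ)) (Φ (hat σ′)) Φ≈ (hat-fromℕ σ) (hat-fromℕ σ′)
    (hat-avoids-213 σ (avoids-213 σ avoids)) (hat-avoids-213 σ′ (avoids-213 σ′ avoids′))
    (Φ-isΦ (hat σ)) (Φ-isΦ (hat σ′)) (Φ-hat-zero σ) (Φ-hat-zero σ′)

-- Uniqueness of permutations increasing on classes.

private
  -- At a first disagreement `b`, `τ′` takes the value `τ b` at some `c` in the class of `b`.
  -- Agreement below `b` leaves only `c > b`, and then monotonicity of `τ′` puts `τ b` above `τ′ b`.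
  class-≮ : {X : Pred (Fin (suc n)) 0ℓ} (τ τ′ : Permutation′ (suc n)) →
            IncreasingOnClasses X τ′ →
            (∀ {a b} → τ ⟨$⟩ʳ a ≡ τ′ ⟨$⟩ʳ b → (X a → X b) × (X b → X a)) →
            ∀ {b} → b ≢ zero → (∀ {a} → a < b → τ ⟨$⟩ʳ a ≡ τ′ ⟨$⟩ʳ a) → ¬ τ ⟨$⟩ʳ b < τ′ ⟨$⟩ʳ b
  class-≮ τ τ′ inc same {b} b≢0 agree lt = go (<-cmp c b)
    where
    c = τ′ ⟨$⟩ˡ (τ ⟨$⟩ʳ b)
    τ′c : τ′ ⟨$⟩ʳ c ≡ τ ⟨$⟩ʳ b
    τ′c = inverseʳ τ′
    b⇔c = same (sym τ′c)
    go : _ → _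
    go (tri< c<b _ _) = ℕ.<⇒≢ c<b (cong toℕ (perm-injective τ (trans (agree c<b) τ′c)))
    go (tri≈ _ c≡b _) = ℕ.<⇒≢ lt (cong toℕ (trans (sym τ′c) (cong (τ′ ⟨$⟩ʳ_) c≡b)))
    go (tri> _ _ b<c) = <-asym lt (subst (τ′ ⟨$⟩ʳ b <_) τ′c (inc b≢0 (proj₁ b⇔c) (proj₂ b⇔c) b<c))

increasing-on-classes-unique :
  {X : Pred (Fin (suc n)) 0ℓ} (τ τ′ : Permutation′ (suc n)) →
  IncreasingOnClasses X τ → IncreasingOnClasses X τ′ → τ ⟨$⟩ʳ zero ≡ τ′ ⟨$⟩ʳ zero →
  (∀ {a b} → τ ⟨$⟩ʳ a ≡ τ′ ⟨$⟩ʳ b → (X a → X b) × (X b → X a)) → τ ≈ τ′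
increasing-on-classes-unique τ τ′ inc inc′ zero≡ same b = go b (<-wellFounded b)
  where
  go : ∀ b → Acc _<_ b → τ ⟨$⟩ʳ b ≡ τ′ ⟨$⟩ʳ b
  go b (acc rec) with b ≟ zero
  ... | yes refl = zero≡
  ... | no b≢0 with <-cmp (τ ⟨$⟩ʳ b) (τ′ ⟨$⟩ʳ b)
  ...   | tri≈ _ eq _ = eq
  ...   | tri< lt _ _ = ⊥-elim (class-≮ τ τ′ inc′ same b≢0 (λ lt → go _ (rec lt)) lt)
  ...   | tri> _ _ gt = ⊥-elim (class-≮ τ′ τ inc
                          (λ eq → let p , q = same (sym eq) in q , p) b≢0 (λ lt → sym (go _ (rec lt))) gt)

-- Deficiencies and exceedances of 321-avoiding permutations.

module _ (π : Permutation′ n) (avoids : π Avoids [321]) {i j : Fin n} (i<j : i < j) where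

  -- An earlier letter above `π i` would give a 321. Without one, `π` sends the positions before `i`
  -- to values below `π i ≤ i`, and these miss `π j`.
  no-inversion-from-deficiency : π ⟨$⟩ʳ i ≤ i → ¬ π ⟨$⟩ʳ j < π ⟨$⟩ʳ i
  no-inversion-from-deficiency πi≤i πj<πi with any? (λ k → k <? i ×-dec π ⟨$⟩ʳ i <? π ⟨$⟩ʳ k)
  ... | yes (k , k<i , πi<πk) = avoids-321 π avoids k<i i<j πi<πk πj<πi
  ... | no none = no-proper-self-injection (_<? i) (π ⟨$⟩ʳ_) (π ⟨$⟩ʳ j) (ℕ.<-≤-trans πj<πi πi≤i)
    (λ {k} k<i →
        ℕ.<-≤-trans (≮∧≢⇒> (λ gt → none (k , k<i , gt)) λ eq → ℕ.<⇒≢ k<i (cong toℕ (perm-injective π (sym eq)))) πi≤i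
      , λ eq → ℕ.<⇒≢ (ℕ.<-trans k<i i<j) (cong toℕ (perm-injective π eq)))
    (λ _ _ → perm-injective π)

  -- Dually, a later letter below `π j` would give a 321. Without one, the values below `π j` all
  -- sit at positions before `j`, themselves below `π j`, and these miss `i`.
  no-inversion-to-exceedance : j < π ⟨$⟩ʳ j → ¬ π ⟨$⟩ʳ j < π ⟨$⟩ʳ i
  no-inversion-to-exceedance j<πj πj<πi with any? (λ k → j <? k ×-dec π ⟨$⟩ʳ k <? π ⟨$⟩ʳ j)
  ... | yes (k , j<k , πk<πj) = avoids-321 π avoids i<j j<k πj<πi πk<πj
  ... | no none = no-proper-self-injection (_<? π ⟨$⟩ʳ j) (π ⟨$⟩ˡ_) i (ℕ.<-trans i<j j<πj)
    (λ {v} v<πj →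
        ℕ.<-trans (≮∧≢⇒> (λ gt → none (π ⟨$⟩ˡ v , gt , subst (_< π ⟨$⟩ʳ j) (sym (inverseʳ π)) v<πj))
                    λ eq → ℕ.<⇒≢ v<πj (cong toℕ (sym (trans (cong (π ⟨$⟩ʳ_) eq) (inverseʳ π))))) j<πj
      , λ eq → <-asym πj<πi (subst (_< π ⟨$⟩ʳ j) (trans (sym (inverseʳ π)) (cong (π ⟨$⟩ʳ_) eq)) v<πj))
    (λ _ _ → perm-injective (flip π))

Deficiency : Permutation′ m → Pred (Fin m) 0ℓ
Deficiency τ b = τ ⟨$⟩ʳ b < b

-- The word (n+1) π(1) ⋯ π(n), from which Ψ deletes the first letter.
crown : Permutation′ n → Permutation′ (suc n)
crown {n} π = insert zero (fromℕ n) π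

punchIn-fromℕ : (i : Fin n) → punchIn (fromℕ n) i ≡ inject₁ i
punchIn-fromℕ zero    = refl
punchIn-fromℕ (suc i) = cong suc (punchIn-fromℕ i)

crown-suc : (π : Permutation′ n) (i : Fin n) → crown π ⟨$⟩ʳ suc i ≡ inject₁ (π ⟨$⟩ʳ i)
crown-suc π i = punchIn-fromℕ (π ⟨$⟩ʳ i)

module _ (π : Permutation′ n) (avoids : π Avoids [321]) where

  private
    -- The shift of positions by one in `crown π` makes the weak inequality for `π` strict.
    deficiency-suc : ∀ {i} → Deficiency (crown π) (suc i) → π ⟨$⟩ʳ i ≤ i
    deficiency-suc {i} lt = ℕ.s≤s⁻¹ (subst (ℕ._< suc (toℕ i))
      (trans (cong toℕ (crown-suc π i)) (toℕ-inject₁ (π ⟨$⟩ʳ i))) lt)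
    suc-deficiency : ∀ {i} → π ⟨$⟩ʳ i ≤ i → Deficiency (crown π) (suc i)
    suc-deficiency {i} le = subst (ℕ._< suc (toℕ i))
      (sym (trans (cong toℕ (crown-suc π i)) (toℕ-inject₁ (π ⟨$⟩ʳ i)))) (s≤s le)
    uninverted : ∀ {i j} → i < j → (π ⟨$⟩ʳ i ≤ i → π ⟨$⟩ʳ j ≤ j) → (π ⟨$⟩ʳ j ≤ j → π ⟨$⟩ʳ i ≤ i) →
                 ¬ π ⟨$⟩ʳ j < π ⟨$⟩ʳ i
    uninverted {i} {j} i<j i⇒j j⇒i with π ⟨$⟩ʳ i ≤? i
    ... | yes πi≤i = no-inversion-from-deficiency π avoids i<j πi≤i
    ... | no πi≰i  = no-inversion-to-exceedance π avoids i<j (ℕ.≰⇒> (πi≰i ∘ j⇒i))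

  crown-increasing : IncreasingOnClasses (Deficiency (crown π)) (crown π)
  crown-increasing {zero} a≢0 _ _ _ = contradiction refl a≢0
  crown-increasing {suc i} {suc j} _ a⇒b b⇒a (s≤s i<j) =
    subst₂ _<_ (sym (crown-suc π i)) (sym (crown-suc π j)) (inject₁-<
      (≮∧≢⇒> (uninverted i<j (deficiency-suc ∘ a⇒b ∘ suc-deficiency) (deficiency-suc ∘ b⇒a ∘ suc-deficiency))
             (λ eq → ℕ.<⇒≢ i<j (cong toℕ (perm-injective π (sym eq))))))

-- The pivot lemma for the inverse of `π` supplies the crossing position. It later guarantees an
-- open slot for each new letter.
crown-crosses : (π : Permutation′ n) (i : Fin n) → ∃[ s ] i < s × crown π ⟨$⟩ʳ s ≤ i
crown-crosses π i =
  let j , j≤i , i≤π⁻¹j = injective⇒existsPivot {f = π ⟨$⟩ˡ_} (perm-injective (flip π)) i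
  in suc (π ⟨$⟩ˡ j) , s≤s i≤π⁻¹j
   , subst (ℕ._≤ toℕ i) (sym (trans (cong toℕ (trans (crown-suc π (π ⟨$⟩ˡ j)) (cong inject₁ (inverseʳ π)))) (toℕ-inject₁ j))) j≤i

-- Insertion of letters into open slots.

-- Words under construction are stored from right to left, so that in (b ∷ a ∷ v) the letter a
-- precedes b.  The letter M is a slot, to be filled with letters larger than those placed so far.
module Slots (M : ℕ) (Top Bottom : Pred ℕ 0ℓ) (top-slot : Top M) (slot-notBottom : ¬ Bottom M) where

  data Step (a b : ℕ) : Set where
    ascent  : a ℕ.< b → ¬ Top a → ¬ Bottom b → Step a b
    descent : b ℕ.< a → Top a → Bottom b → Step a b

  -- `b` is the letter just to the right of the stored word. The end of the list is the beginning of
  -- the word, whose letter has no predecessor.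
  Chain : ℕ → List ℕ → Set
  Chain b []      = ¬ Bottom b
  Chain b (a ∷ v) = Step a b × Chain a v

  -- For each letter c, the letters below c to its left increase.
  Avoiding : List ℕ → Set
  Avoiding []      = ⊤
  Avoiding (c ∷ v) = AllPairs ℕ._≥_ (filter (ℕ._<? c) v) × Avoiding v

  -- A slot counts as a top, so the letter to its right is a bottom below it; only the steps from
  -- there leftwards are rebuilt. `P` carries size information about that letter.
  Chain-replace : ∀ {P : Pred ℕ 0ℓ} {b} s {u w} → All P (b ∷ s) → Chain b (s ++ M ∷ u) →
                  (∀ {b} → P b → b ℕ.< M → Bottom b → Chain M u → Chain b w) → Chain b (s ++ w)
  Chain-replace [] (p ∷ _) (ascent _ ¬top _ , _) _ = contradiction top-slot ¬top
  Chain-replace [] (p ∷ _) (descent lt _ bottom , chain) f = f p lt bottom chain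
  Chain-replace (c ∷ s) (_ ∷ ps) (step , chain) f = step , Chain-replace s ps chain f

  filter-skip : ∀ {c} s w {u} → All (c ℕ.≤_) w → filter (ℕ._<? c) (s ++ w ++ u) ≡ filter (ℕ._<? c) (s ++ u)
  filter-skip {c} s w {u} c≤w = begin
    filter (ℕ._<? c) (s ++ w ++ u)                                       ≡⟨ filter-++ (ℕ._<? c) s (w ++ u) ⟩
    filter (ℕ._<? c) s ++ filter (ℕ._<? c) (w ++ u)                      ≡⟨ cong (filter (ℕ._<? c) s ++_) (filter-++ (ℕ._<? c) w u) ⟩
    filter (ℕ._<? c) s ++ filter (ℕ._<? c) w ++ filter (ℕ._<? c) u       ≡⟨ cong (λ ws → filter (ℕ._<? c) s ++ ws ++ filter (ℕ._<? c) u)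
                                                                              (filter-none (ℕ._<? c) (All.map ℕ.≤⇒≯ c≤w)) ⟩
    filter (ℕ._<? c) s ++ filter (ℕ._<? c) u                             ≡⟨ filter-++ (ℕ._<? c) s u ⟨
    filter (ℕ._<? c) (s ++ u)                                            ∎
    where open ≡-Reasoning

  -- The letters to the right of the slot do not exceed `M` or any letter of `w`, so the replacement
  -- leaves their lists of smaller letters unchanged.
  Avoiding-replace : ∀ s w {u} → All (λ c → All (c ℕ.≤_) (M ∷ w)) s →
                     Avoiding (s ++ M ∷ u) → Avoiding (w ++ u) → Avoiding (s ++ w ++ u)
  Avoiding-replace [] w [] _ new = new
  Avoiding-replace (c ∷ s) w {u} ((c≤M ∷ c≤w) ∷ s≤) (sorted , avoiding) new =
    subst (AllPairs ℕ._≥_) (trans (filter-skip s (M ∷ []) (c≤M ∷ [])) (sym (filter-skip s w c≤w))) sorted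
    , Avoiding-replace s w s≤ avoiding new

  Avoiding-suffix : ∀ s {u} → Avoiding (s ++ u) → Avoiding u
  Avoiding-suffix []      avoiding       = avoiding
  Avoiding-suffix (_ ∷ s) (_ , avoiding) = Avoiding-suffix s avoiding

  SmallOrSlot : ℕ → Pred ℕ 0ℓ
  SmallOrSlot x z = z ℕ.< x ⊎ z ≡ M

  first-slot : ∀ {v} → M ∈ v → ∃[ s ] ∃[ u ] v ≡ s ++ M ∷ u × M ∉ s
  first-slot {a ∷ v} M∈ with a ℕ.≟ M
  ... | yes refl = [] , v , refl , λ ()
  ... | no a≢M with M∈
  ...   | here M≡a = contradiction (sym M≡a) a≢M
  ...   | there M∈v with s , u , refl , M∉s ← first-slot M∈v =
    a ∷ s , u , refl , λ { (here M≡a) → a≢M (sym M≡a) ; (there M∈s) → M∉s M∈s }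

  -- The four ways in which a new largest letter x fills a slot, in stored order.
  data Filling (x : ℕ) : List ℕ → Set where
    append  : Top x → Bottom x → Filling x (x ∷ M ∷ [])
    prepend : ¬ Top x → ¬ Bottom x → Filling x (M ∷ x ∷ [])
    split   : ¬ Top x → Bottom x → Filling x (M ∷ x ∷ M ∷ [])
    close   : Top x → ¬ Bottom x → Filling x (x ∷ [])

  module _ {x} (x<M : x ℕ.< M) where

    -- A slot is no bottom, so any letter to its left is a nontop below it, hence not a slot and
    -- smaller than `x`; the ascent survives.
    Chain-relabel : ∀ {u} → All (SmallOrSlot x) u → ¬ Bottom x → Chain M u → Chain x u
    Chain-relabel [] ¬bottom _ = ¬bottom
    Chain-relabel (inj₁ a<x ∷ _) ¬bottom (ascent _ ¬top _ , chain) = ascent a<x ¬top ¬bottom , chain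
    Chain-relabel (inj₂ refl ∷ _) ¬bottom (ascent _ ¬top _ , _) = contradiction top-slot ¬top
    Chain-relabel (_ ∷ _) _ (descent _ _ bottom , _) = contradiction bottom slot-notBottom

    Chain-fill : ∀ {b w u} → Filling x w → All (SmallOrSlot x) u → b ℕ.< x → Bottom b → Chain M u → Chain b (w ++ u)
    Chain-fill (append top bottom) small b<x bot chain =
      descent b<x top bot , descent x<M top-slot bottom , chain
    Chain-fill (prepend ¬top ¬bottom) small b<x bot chain =
      descent (ℕ.<-trans b<x x<M) top-slot bot , ascent x<M ¬top slot-notBottom , Chain-relabel small ¬bottom chain
    Chain-fill (split ¬top bottom) small b<x bot chain =
      descent (ℕ.<-trans b<x x<M) top-slot bot , ascent x<M ¬top slot-notBottom , descent x<M top-slot bottom , chain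
    Chain-fill (close top ¬bottom) small b<x bot chain =
      descent b<x top bot , Chain-relabel small ¬bottom chain

    filter-small : ∀ {u} → All (SmallOrSlot x) u → filter (ℕ._<? x) u ≡ filter (ℕ._<? M) u
    filter-small [] = refl
    filter-small {z ∷ u} (inj₁ z<x ∷ small) = trans (filter-accept (ℕ._<? x) z<x)
      (trans (cong (z ∷_) (filter-small small)) (sym (filter-accept (ℕ._<? M) (ℕ.<-trans z<x x<M))))
    filter-small (inj₂ refl ∷ small) = trans (filter-reject (ℕ._<? x) (ℕ.<-asym x<M))
      (trans (filter-small small) (sym (filter-reject (ℕ._<? M) (ℕ.<-irrefl refl))))

    Avoiding-relabel : ∀ {u} → All (SmallOrSlot x) u → Avoiding (M ∷ u) → Avoiding (x ∷ u)
    Avoiding-relabel small (sorted , avoiding) = subst (AllPairs ℕ._≥_) (sym (filter-small small)) sorted , avoiding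

    x-above : ∀ {u} → All (SmallOrSlot x) u → All (x ℕ.≥_) (filter (ℕ._<? M) u)
    x-above {u} small = subst (All (x ℕ.≥_)) (filter-small small) (All.map ℕ.<⇒≤ (All.all-filter (ℕ._<? x) u))

    Avoiding-slot : ∀ {u} → All (SmallOrSlot x) u → Avoiding (x ∷ u) → Avoiding (M ∷ x ∷ u)
    Avoiding-slot {u} small (sorted , avoiding) =
      subst (AllPairs ℕ._≥_) (sym (filter-accept (ℕ._<? M) x<M))
        (x-above small ∷ subst (AllPairs ℕ._≥_) (filter-small small) sorted)
      , sorted , avoiding

    Avoiding-append : ∀ {u} → All (SmallOrSlot x) u → Avoiding (M ∷ u) → Avoiding (x ∷ M ∷ u)
    Avoiding-append small avoiding = Avoiding-relabel (inj₂ refl ∷ small)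
      (subst (AllPairs ℕ._≥_) (sym (filter-reject (ℕ._<? M) (ℕ.<-irrefl refl))) (proj₁ avoiding) , avoiding)

    Avoiding-fill : ∀ {w u} → Filling x w → All (SmallOrSlot x) u → Avoiding (M ∷ u) → Avoiding (w ++ u)
    Avoiding-fill (append _ _)  small avoiding = Avoiding-append small avoiding
    Avoiding-fill (prepend _ _) small avoiding = Avoiding-slot small (Avoiding-relabel small avoiding)
    Avoiding-fill (split _ _)   small avoiding = Avoiding-slot (inj₂ refl ∷ small) (Avoiding-append small avoiding)
    Avoiding-fill (close _ _)   small avoiding = Avoiding-relabel small avoiding

    Filling-≥ : ∀ {c w} → c ℕ.≤ x → Filling x w → All (c ℕ.≤_) w
    Filling-≥ {c} c≤x filling = go filling
      where
      c≤M : c ℕ.≤ M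
      c≤M = ℕ.≤-trans c≤x (ℕ.<⇒≤ x<M)
      go : ∀ {w} → Filling x w → All (c ℕ.≤_) w
      go (append _ _)  = c≤x ∷ c≤M ∷ []
      go (prepend _ _) = c≤M ∷ c≤x ∷ []
      go (split _ _)   = c≤M ∷ c≤x ∷ c≤M ∷ []
      go (close _ _)   = c≤x ∷ []

  -- The count is 1, plus one for a bottom, minus one for a top.
  newSlots : ∀ {x w} → Filling x w → ℕ
  newSlots (append _ _)  = 1
  newSlots (prepend _ _) = 1
  newSlots (split _ _)   = 2
  newSlots (close _ _)   = 0

  Filling-↭ : ∀ {x w} (filling : Filling x w) → w ↭ x ∷ replicate (newSlots filling) M
  Filling-↭ (append _ _)  = ↭-refl
  Filling-↭ (prepend _ _) = ↭-swap _ _ ↭-refl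
  Filling-↭ (split _ _)   = ↭-swap _ _ ↭-refl
  Filling-↭ (close _ _)   = ↭-refl

  -- The letters 0, …, y have been placed, and k slots are left; the final letter 0 is not
  -- part of the word.
  record State (y k : ℕ) : Set where
    field
      word     : List ℕ
      letters  : word ↭ replicate k M ++ applyDownFrom suc y
      chain    : Chain 0 word
      avoiding : Avoiding (0 ∷ word)

    small : All (SmallOrSlot (suc y)) word
    small = All-resp-↭ (↭-sym letters)
      (All.++⁺ (All.replicate⁺ k (inj₂ refl)) (All.applyDownFrom⁺₁ suc y (λ i<y → inj₁ (s≤s i<y))))

  -- Using the rightmost slot, the first in stored order, makes every letter to its right smaller
  -- than the new one, so avoidance is preserved.
  fill : ∀ {y k w} → suc y ℕ.< M → State y (suc k) → (filling : Filling (suc y) w) → State (suc y) (newSlots filling ℕ.+ k)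
  fill {y} {k} {w} x<M state filling
    with s , u , refl , M∉s ← first-slot (∈-resp-↭ (↭-sym (State.letters state)) (here refl)) = record
    { word     = s ++ w ++ u
    ; letters  = begin
        s ++ w ++ u                                                        ↭⟨ shifts s w ⟩
        w ++ s ++ u                                                        ↭⟨ ++⁺ (Filling-↭ filling) (drop-mid s [] letters) ⟩
        suc y ∷ replicate e M ++ replicate k M ++ applyDownFrom suc y       ≡⟨ cong (suc y ∷_) (++-assoc (replicate e M) (replicate k M) _) ⟨
        suc y ∷ (replicate e M ++ replicate k M) ++ applyDownFrom suc y     ≡⟨ cong (λ ms → suc y ∷ ms ++ applyDownFrom suc y) (replicate-++ e) ⟩
        suc y ∷ replicate (e ℕ.+ k) M ++ applyDownFrom suc y                ↭⟨ shift (suc y) (replicate (e ℕ.+ k) M) _ ⟨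
        replicate (e ℕ.+ k) M ++ suc y ∷ applyDownFrom suc y                ∎
    ; chain    = Chain-replace s (inj₁ (s≤s z≤n) ∷ small-s) chain λ small-b b<M bottom →
        Chain-fill x<M filling small-u (strict small-b b<M) bottom
    ; avoiding = Avoiding-replace (0 ∷ s) w
        (All.map (λ c<x → ℕ.<⇒≤ (ℕ.<-trans c<x x<M) ∷ Filling-≥ x<M (ℕ.<⇒≤ c<x) filling)
          (s≤s z≤n ∷ All.tabulate λ c∈ → strict′ c∈ (All.lookup small-s c∈)))
        avoiding (Avoiding-fill x<M filling small-u (Avoiding-suffix (0 ∷ s) avoiding))
    }
    where
    open State state
    open PermutationReasoning
    e = newSlots filling
    replicate-++ : ∀ e → replicate e M ++ replicate k M ≡ replicate (e ℕ.+ k) M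
    replicate-++ zero    = refl
    replicate-++ (suc e) = cong (M ∷_) (replicate-++ e)
    small-s : All (SmallOrSlot (suc y)) s
    small-s = All.++⁻ˡ s small
    small-u : All (SmallOrSlot (suc y)) u
    small-u = All.tail (All.++⁻ʳ s small)
    strict : ∀ {b} → SmallOrSlot (suc y) b → b ℕ.< M → b ℕ.< suc y
    strict (inj₁ b<x) _ = b<x
    strict (inj₂ refl) M<M = contradiction M<M (ℕ.<-irrefl refl)
    strict′ : ∀ {c} → c ∈ s → SmallOrSlot (suc y) c → c ℕ.< suc y
    strict′ _  (inj₁ c<x) = c<x
    strict′ c∈ (inj₂ refl) = contradiction c∈ M∉s

  Chain-tabulate : (f : Fin (suc m) → ℕ) → Chain (f zero) (tabulate (f ∘ suc)) →
                   (∀ i → Step (f (suc i)) (f (inject₁ i))) × ¬ Bottom (f (fromℕ m))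
  Chain-tabulate {zero}  f ¬bottom = (λ ()) , ¬bottom
  Chain-tabulate {suc m} f (step , chain) =
    let steps , ¬bottom = Chain-tabulate (f ∘ suc) chain
    in (λ { zero → step ; (suc i) → steps i }) , ¬bottom

  private
    filter-tabulate : ∀ {c} (f : Fin m → ℕ) → AllPairs ℕ._≥_ (filter (ℕ._<? c) (tabulate f)) →
                      ∀ {j k} → j < k → f j ℕ.< c → f k ℕ.< c → f k ℕ.≤ f j
    filter-tabulate {suc m} {c} f sorted {zero} {suc k} _ fj<c fk<c
      with fk≤ ∷ _ ← subst (AllPairs ℕ._≥_) (filter-accept (ℕ._<? c) fj<c) sorted =
      All.lookup fk≤ (∈-filter⁺ (ℕ._<? c) (∈-tabulate⁺ k) fk<c)
    filter-tabulate {suc m} {c} f sorted {suc j} {suc k} (s≤s j<k) = filter-tabulate (f ∘ suc) (tail (f zero ℕ.<? c)) j<k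
      where
      tail : Dec (f zero ℕ.< c) → AllPairs ℕ._≥_ (filter (ℕ._<? c) (tabulate (f ∘ suc)))
      tail (yes lt) with _ ∷ sorted′ ← subst (AllPairs ℕ._≥_) (filter-accept (ℕ._<? c) lt) sorted = sorted′
      tail (no ≮) = subst (AllPairs ℕ._≥_) (filter-reject (ℕ._<? c) ≮) sorted

  -- Indices run from right to left, so the excluded order is 213 read backwards.
  Avoiding-tabulate : (f : Fin m → ℕ) → Avoiding (tabulate f) →
                      ∀ {i j k} → i < j → j < k → f j ℕ.< f k → ¬ f k ℕ.< f i
  Avoiding-tabulate {suc m} f (sorted , _) {zero} {suc j} {suc k} _ (s≤s j<k) fj<fk fk<fi =
    ℕ.<⇒≱ fj<fk (filter-tabulate (f ∘ suc) sorted j<k (ℕ.<-trans fj<fk fk<fi) fk<fi)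
  Avoiding-tabulate {suc m} f (_ , avoiding) {suc i} {suc j} {suc k} (s≤s i<j) (s≤s j<k) =
    Avoiding-tabulate (f ∘ suc) avoiding i<j j<k

-- Lists of letters as permutations.

tabulate-lookup-cast : (xs : List A) (eq : m ≡ length xs) → tabulate (λ i → lookup xs (cast eq i)) ≡ xs
tabulate-lookup-cast {m = zero}  []       _  = refl
tabulate-lookup-cast {m = suc m} (x ∷ xs) eq = cong (x ∷_) (tabulate-lookup-cast xs (ℕ.suc-injective eq))

↭-allFin⇒tabulate : {w : List (Fin m)} → allFin m ↭ w → ∃[ π ] w ≡ tabulate (π ⟨$⟩ʳ_)
↭-allFin⇒tabulate {m} {w} ↭w = π , trans (sym (tabulate-lookup-cast w len)) (tabulate-cong agree)
  where
  θ = onIndices (↭⇒↭ₛ ↭w)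
  len-allFin : length (allFin m) ≡ m
  len-allFin = length-tabulate {n = m} (λ i → i)
  len : m ≡ length w
  len = trans (sym len-allFin) (↭-length ↭w)
  π : Permutation′ m
  π = cast-id len ∘ₚ flip θ ∘ₚ cast-id len-allFin
  agree : ∀ i → lookup w (cast len i) ≡ π ⟨$⟩ʳ i
  agree i = begin
    lookup w j                              ≡⟨ cong (lookup w) (inverseʳ θ) ⟨
    lookup w (θ ⟨$⟩ʳ (θ ⟨$⟩ˡ j))            ≡⟨ onIndices-lookup (setoid _) (↭⇒↭ₛ ↭w) (θ ⟨$⟩ˡ j) ⟨
    lookup (allFin m) (θ ⟨$⟩ˡ j)            ≡⟨ cong (lookup (allFin m)) (cast-involutive (sym len-allFin) len-allFin (θ ⟨$⟩ˡ j)) ⟨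
    lookup (allFin m) (cast (sym len-allFin) (cast len-allFin (θ ⟨$⟩ˡ j)))  ≡⟨ lookup-tabulate (λ i → i) (π ⟨$⟩ʳ i) ⟩
    π ⟨$⟩ʳ i                                ∎
    where
    open ≡-Reasoning
    j = cast len i

opposite-inject₁ : (i : Fin n) → opposite (inject₁ i) ≡ suc (opposite i)
opposite-inject₁ zero    = refl
opposite-inject₁ (suc i) = cong inject₁ (opposite-inject₁ i)

opposite-fromℕ : ∀ n → opposite (fromℕ n) ≡ zero
opposite-fromℕ zero    = refl
opposite-fromℕ (suc n) = cong inject₁ (opposite-fromℕ n)

opposite-antitone : {i j : Fin n} → i < j → opposite j < opposite i
opposite-antitone {n} {i} {j} i<j = subst₂ ℕ._<_ (sym (opposite-prop j)) (sym (opposite-prop i))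
  (ℕ.∸-monoʳ-< (s≤s i<j) (toℕ<n j))

-- Deficiencies crossing a level.

iverson : {P : Set} → Dec P → A → List A
iverson (yes _) x = x ∷ []
iverson (no _)  _ = []

∈-iverson⁺ : {P : Set} (d : Dec P) {x : A} → P → x ∈ iverson d x
∈-iverson⁺ (yes _) _ = here refl
∈-iverson⁺ (no ¬p) p = contradiction p ¬p

∈-iverson⁻ : {P : Set} (d : Dec P) {x y : A} → y ∈ iverson d x → P × y ≡ x
∈-iverson⁻ (yes p) (here eq) = p , eq

iverson-unique : {P : Set} (d : Dec P) {x : A} {xs : List A} → x ∉ xs → AllPairs _≢_ xs → AllPairs _≢_ (iverson d x ++ xs)
iverson-unique (yes _) x∉ xs! = All.tabulate (λ { y∈ refl → x∉ y∈ }) ∷ xs!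
iverson-unique (no _)  _  xs! = xs!

module _ (τ : Permutation′ m) where

  -- The slots left when the letters below y have been placed are as many as the
  -- deficiencies that cross y.
  pending? : ∀ y → Decidable (λ s → y ℕ.≤ toℕ s × toℕ (τ ⟨$⟩ʳ s) ℕ.< y)
  pending? y s = (y ℕ.≤? toℕ s) ×-dec (toℕ (τ ⟨$⟩ʳ s) ℕ.<? y)

  pending : ℕ → List (Fin m)
  pending y = filter (pending? y) (allFin m)

  top? : Decidable (Deficiency τ)
  top? b = τ ⟨$⟩ʳ b <? b

  bottom? : Decidable (λ b → b < τ ⟨$⟩ˡ b)
  bottom? b = b <? τ ⟨$⟩ˡ b

  ∈-pending⁺ : ∀ {y s} → y ℕ.≤ toℕ s → toℕ (τ ⟨$⟩ʳ s) ℕ.< y → s ∈ pending y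
  ∈-pending⁺ {y} y≤s τs<y = ∈-filter⁺ (pending? y) (∈-allFin _) (y≤s , τs<y)

  ∈-pending⁻ : ∀ {y s} → s ∈ pending y → y ℕ.≤ toℕ s × toℕ (τ ⟨$⟩ʳ s) ℕ.< y
  ∈-pending⁻ {y} s∈ = proj₂ (∈-filter⁻ (pending? y) {xs = allFin m} s∈)

  pending-unique : ∀ y → AllPairs _≢_ (pending y)
  pending-unique y = Unique.filter⁺ (pending? y) (Unique.allFin⁺ m)

  -- Past level `b`, the position `b` stops crossing if it is a deficiency, and the preimage of `b`
  -- starts crossing if it exceeds `b`. The number of slots changes in the same way.
  pending-step : ∀ b → iverson (top? b) b ++ pending (suc (toℕ b)) ↭ iverson (bottom? b) (τ ⟨$⟩ˡ b) ++ pending (toℕ b)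
  pending-step b = ∼bag⇒↭ (unique∧set⇒bag
    (iverson-unique (top? b) (λ b∈ → ℕ.<-irrefl refl (proj₁ (∈-pending⁻ b∈))) (pending-unique (suc (toℕ b))))
    (iverson-unique (bottom? b) (λ t∈ → ℕ.<⇒≢ (proj₂ (∈-pending⁻ t∈)) (cong toℕ (inverseʳ τ))) (pending-unique (toℕ b)))
    (mk⇔ to from))
    where
    t = τ ⟨$⟩ˡ b
    to : ∀ {z} → z ∈ iverson (top? b) b ++ pending (suc (toℕ b)) → z ∈ iverson (bottom? b) t ++ pending (toℕ b)
    to {z} z∈ with ∈-++⁻ (iverson (top? b) b) z∈
    ... | inj₁ z∈b with τb<b , refl ← ∈-iverson⁻ (top? b) z∈b =
      ∈-++⁺ʳ (iverson (bottom? b) t) (∈-pending⁺ ℕ.≤-refl τb<b)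
    ... | inj₂ z∈p with b<z , τz≤b ← ∈-pending⁻ z∈p | τ ⟨$⟩ʳ z ≟ b
    ...   | yes refl = subst (λ x → x ∈ iverson (bottom? b) t ++ pending (toℕ b)) (inverseˡ τ)
      (∈-++⁺ˡ (∈-iverson⁺ (bottom? b) (subst (b <_) (sym (inverseˡ τ)) b<z)))
    ...   | no τz≢b = ∈-++⁺ʳ (iverson (bottom? b) t) (∈-pending⁺ (ℕ.<⇒≤ b<z) (≤∧≢⇒< (ℕ.s≤s⁻¹ τz≤b) τz≢b))
    from : ∀ {z} → z ∈ iverson (bottom? b) t ++ pending (toℕ b) → z ∈ iverson (top? b) b ++ pending (suc (toℕ b))
    from {z} z∈ with ∈-++⁻ (iverson (bottom? b) t) z∈
    ... | inj₁ z∈t with b<t , refl ← ∈-iverson⁻ (bottom? b) z∈t =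
      ∈-++⁺ʳ (iverson (top? b) b) (∈-pending⁺ b<t (s≤s (ℕ.≤-reflexive (cong toℕ (inverseʳ τ)))))
    ... | inj₂ z∈p with b≤z , τz<b ← ∈-pending⁻ z∈p | z ≟ b
    ...   | yes refl = ∈-++⁺ˡ (∈-iverson⁺ (top? b) τz<b)
    ...   | no z≢b = ∈-++⁺ʳ (iverson (top? b) b) (∈-pending⁺ (≤∧≢⇒< b≤z (z≢b ∘ sym)) (ℕ.m<n⇒m<1+n τz<b))

  -- The quantifiers differ so that the slot, a number that is no letter, is vacuously a top and
  -- never a bottom.
  Top Bottom : Pred ℕ 0ℓ
  Top z    = ∀ b → toℕ b ≡ z → Deficiency τ b
  Bottom z = ∃[ b ] toℕ b ≡ z × b < τ ⟨$⟩ˡ b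

  top⁻ : ∀ {b} → Top (toℕ b) → Deficiency τ b
  top⁻ top = top _ refl

  top⁺ : ∀ {b} → Deficiency τ b → Top (toℕ b)
  top⁺ lt _ eq with refl ← toℕ-injective eq = lt

  bottom⁻ : ∀ {b} → Bottom (toℕ b) → b < τ ⟨$⟩ˡ b
  bottom⁻ (_ , eq , lt) with refl ← toℕ-injective eq = lt

  bottom⁺ : ∀ {b} → b < τ ⟨$⟩ˡ b → Bottom (toℕ b)
  bottom⁺ lt = _ , refl , lt

-- Words with prescribed descent tops and bottoms.

record Realisation (τ : Permutation′ (suc n)) : Set where
  field
    ρ       : Permutation′ (suc n)
    last    : ρ ⟨$⟩ʳ fromℕ n ≡ zero
    avoids  : Avoids213 ρ
    tops    : ∀ {x} → DescentTop ρ x ⇔ Deficiency τ x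
    bottoms : ∀ {y} → DescentBottom ρ y ⇔ y < τ ⟨$⟩ˡ y

letters↭ : ∀ {v} → v ↭ applyDownFrom suc n → map toℕ (allFin (suc n)) ↭ 0 ∷ v
letters↭ {n} {v} v↭ = ↭-trans (∼bag⇒↭ (unique∧set⇒bag
    (Unique.map⁺ toℕ-injective (Unique.allFin⁺ (suc n)))
    (Unique.applyDownFrom⁺₁ (λ i → i) (suc n) (λ j<i _ eq → ℕ.<⇒≢ j<i (sym eq)))
    (mk⇔ to from)))
  (↭-trans (↭-reflexive (sym (applyDownFrom-∷ʳ (λ i → i) n)))
    (↭-trans (↭-sym (∷↭∷ʳ 0 (applyDownFrom suc n))) (↭-prep 0 (↭-sym v↭))))
  where
  to : ∀ {z} → z ∈ map toℕ (allFin (suc n)) → z ∈ applyDownFrom (λ i → i) (suc n)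
  to z∈ with b , _ , refl ← ∈-map⁻ toℕ z∈ = ∈-applyDownFrom⁺ (λ i → i) (toℕ<n b)
  from : ∀ {z} → z ∈ applyDownFrom (λ i → i) (suc n) → z ∈ map toℕ (allFin (suc n))
  from z∈ with z , z<m , refl ← ∈-applyDownFrom⁻ (λ i → i) z∈ =
    subst (_∈ map toℕ (allFin (suc n))) (toℕ-fromℕ< z<m) (∈-map⁺ toℕ (∈-allFin (fromℕ< z<m)))

as-permutation : ∀ {v} → v ↭ applyDownFrom suc n →
                 ∃[ θ ] 0 ∷ v ≡ tabulate {n = suc n} (λ i → toℕ (θ ⟨$⟩ʳ i))
as-permutation v↭ with w , eq , ↭w ← ↭-map-inv toℕ (letters↭ v↭)
    with θ , refl ← ↭-allFin⇒tabulate ↭w =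
  θ , trans eq (map-tabulate (θ ⟨$⟩ʳ_) toℕ)

module SlotsOf (τ : Permutation′ (suc n)) where

  toℕ≢slot : ∀ (b : Fin (suc n)) → toℕ b ≢ suc n
  toℕ≢slot b = ℕ.<⇒≢ (toℕ<n b)

  top-slot : Top τ (suc n)
  top-slot b eq = contradiction eq (toℕ≢slot b)

  slot-notBottom : ¬ Bottom τ (suc n)
  slot-notBottom (b , eq , _) = toℕ≢slot b eq

  open Slots (suc n) (Top τ) (Bottom τ) top-slot slot-notBottom public

  module _ (θ : Permutation′ (suc n)) (θ-zero : θ ⟨$⟩ʳ zero ≡ zero)
           (steps : ∀ i → Step (toℕ (θ ⟨$⟩ʳ suc i)) (toℕ (θ ⟨$⟩ʳ inject₁ i)))
           (first : ¬ Bottom τ (toℕ (θ ⟨$⟩ʳ fromℕ n)))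
           (avoids : ∀ {i j k} → i < j → j < k → θ ⟨$⟩ʳ j < θ ⟨$⟩ʳ k → ¬ θ ⟨$⟩ʳ k < θ ⟨$⟩ʳ i) where

    private
      ρ : Permutation′ (suc n)
      -- `θ` lists the letters in stored order, from right to left.
      ρ = reverse ∘ₚ θ

      last : ρ ⟨$⟩ʳ fromℕ n ≡ zero
      last = trans (cong (θ ⟨$⟩ʳ_) (opposite-fromℕ n)) θ-zero

      open EndsInZero ρ last

      step : ∀ i → Step (toℕ (ρ ⟨$⟩ʳ inject₁ i)) (toℕ (next ⟨$⟩ʳ (ρ ⟨$⟩ʳ inject₁ i)))
      step i = subst₂ (λ a b → Step (toℕ a) (toℕ b)) (cong (θ ⟨$⟩ʳ_) (sym (opposite-inject₁ i)))
        (sym (next-inject₁ i)) (steps (opposite i))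

      deficiency⇒top : ∀ {x} → Letter x → Deficiency τ x → DescentTop ρ x
      deficiency⇒top final ()
      deficiency⇒top (other i) lt with step i
      ... | ascent _ ¬top _ = contradiction (top⁺ τ lt) ¬top
      ... | descent next< _ _ = ⇒top next<

      top⇒deficiency : ∀ {x} → Letter x → DescentTop ρ x → Deficiency τ x
      top⇒deficiency final top = contradiction top zero-notTop
      top⇒deficiency (other i) top with step i
      ... | ascent lt _ _ = contradiction (top⇒ top) (<-asym lt)
      ... | descent _ top′ _ = top⁻ τ top′

      bottom⇒Bottom : ∀ {x} → Letter x → DescentBottom ρ (next ⟨$⟩ʳ x) → Bottom τ (toℕ (next ⟨$⟩ʳ x))
      bottom⇒Bottom final bottom = contradiction (bottom⇒top bottom) zero-notTop
      bottom⇒Bottom (other i) bottom with step i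
      ... | ascent lt _ _ = contradiction (bottom⇒ bottom) (<-asym lt)
      ... | descent _ _ bot = bot

      Bottom⇒bottom : ∀ {x} → Letter x → Bottom τ (toℕ (next ⟨$⟩ʳ x)) → DescentBottom ρ (next ⟨$⟩ʳ x)
      Bottom⇒bottom final bot = contradiction (subst (Bottom τ ∘ toℕ) next-zero bot) first
      Bottom⇒bottom (other i) bot with step i
      ... | ascent _ _ ¬bot = contradiction bot ¬bot
      ... | descent next< _ _ = ⇒bottom next<

      previous : ∀ {y} → next ⟨$⟩ʳ (next ⟨$⟩ˡ y) ≡ y
      previous = inverseʳ next

    reverse-realises : Realisation τ
    reverse-realises = record
      { ρ       = ρ
      ; last    = last
      ; avoids  = λ i<j j<k → avoids (opposite-antitone j<k) (opposite-antitone i<j)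
      ; tops    = λ {x} → mk⇔ (top⇒deficiency (letter x)) (deficiency⇒top (letter x))
      ; bottoms = λ {y} → mk⇔
          (λ bottom → bottom⁻ τ (subst (Bottom τ ∘ toℕ) previous
            (bottom⇒Bottom (letter (next ⟨$⟩ˡ y)) (subst (DescentBottom ρ) (sym previous) bottom))))
          (λ lt → subst (DescentBottom ρ) previous
            (Bottom⇒bottom (letter (next ⟨$⟩ˡ y)) (subst (Bottom τ ∘ toℕ) (sym previous) (bottom⁺ τ lt))))
      }

  complete-state-realises : State n 0 → Realisation τ
  complete-state-realises state with θ , eq ← as-permutation (State.letters state) =
    let head≡ , tail≡ = ∷-injective eq
        steps , first = Chain-tabulate (λ i → toℕ (θ ⟨$⟩ʳ i)) (subst₂ Chain head≡ tail≡ (State.chain state))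
    in reverse-realises θ (toℕ-injective (sym head≡)) steps first
         (Avoiding-tabulate (λ i → toℕ (θ ⟨$⟩ʳ i)) (subst Avoiding eq (State.avoiding state)))

  -- The new slots replace the one that is used, whence `ℕ.pred`; in each of the four cases
  -- `pending-step` gives the count.
  filling : ∀ b → let k = length (pending τ (toℕ b)) in 1 ℕ.≤ k →
            ∃[ w ] ∃[ f ] newSlots {toℕ b} {w} f ℕ.+ ℕ.pred k ≡ length (pending τ (suc (toℕ b)))
  filling b 1≤k with top? τ b | bottom? τ b | ↭-length (pending-step τ b) | ℕ.suc-pred _ ⦃ ℕ.>-nonZero 1≤k ⦄
  ... | yes top | yes bot | eq | k≡ = _ , append (top⁺ τ top) (bottom⁺ τ bot) , trans k≡ (sym (ℕ.suc-injective eq))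
  ... | no ¬top | no ¬bot | eq | k≡ = _ , prepend (¬top ∘ top⁻ τ) (¬bot ∘ bottom⁻ τ) , trans k≡ (sym eq)
  ... | no ¬top | yes bot | eq | k≡ = _ , split (¬top ∘ top⁻ τ) (bottom⁺ τ bot) , trans (cong suc k≡) (sym eq)
  ... | yes top | no ¬bot | eq | _  = _ , close (top⁺ τ top) (¬bot ∘ bottom⁻ τ) , cong ℕ.pred (sym eq)

  module _ (0-bottom : zero {n} < τ ⟨$⟩ˡ zero) (crosses : ∀ (i : Fin n) → ∃[ s ] i < s × τ ⟨$⟩ʳ s ≤ i) where

    pending-nonempty : ∀ (i : Fin n) → 1 ℕ.≤ length (pending τ (suc (toℕ i)))
    pending-nonempty i = let s , i<s , τs≤i = crosses i in ∈⇒1≤length (∈-pending⁺ τ i<s (s≤s τs≤i))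

    -- Nothing crosses level 0, and `zero`, a bottom but not a top, opens exactly one slot.
    one-pending : 1 ≡ length (pending τ 1)
    one-pending with top? τ zero | bottom? τ zero | ↭-length (pending-step τ zero)
    ... | yes () | _ | _
    ... | no _ | no ¬bot | _ = contradiction 0-bottom ¬bot
    ... | no _ | yes _ | eq = sym (trans eq (cong (suc ∘ length)
      (filter-none (pending? τ 0) (All.universal (λ { _ (_ , ()) }) (allFin (suc n))))))

    construct : ∀ (i : Fin (suc n)) → State (toℕ i) (length (pending τ (suc (toℕ i))))
    construct = <-weakInduction (λ i → State (toℕ i) (length (pending τ (suc (toℕ i))))) initial step
      where
      initial : State 0 (length (pending τ 1))
      initial = subst (State 0) one-pending (record
        -- The word starts as a single slot before the final 0, which is a descent bottom.
        { word     = suc n ∷ []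
        ; letters  = ↭-refl
        ; chain    = descent (s≤s z≤n) top-slot (bottom⁺ τ 0-bottom) , slot-notBottom
        ; avoiding = [] , [] , tt
        })
      step : ∀ i → State (toℕ (inject₁ i)) (length (pending τ (suc (toℕ (inject₁ i))))) →
             State (suc (toℕ i)) (length (pending τ (suc (suc (toℕ i)))))
      step i state =
        let 1≤k = pending-nonempty i
            w , f , eq = filling (suc i) 1≤k
        in subst (State (suc (toℕ i))) eq (fill (s≤s (toℕ<n i))
             (subst (State (toℕ i)) (sym (ℕ.suc-pred _ ⦃ ℕ.>-nonZero 1≤k ⦄))
               (subst (λ y → State y (length (pending τ (suc y)))) (toℕ-inject₁ i) state)) f)

    none-pending : length (pending τ (suc n)) ≡ 0
    none-pending = cong length (filter-none (pending? τ (suc n))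
      (All.universal (λ s (m≤s , _) → ℕ.<⇒≱ (toℕ<n s) m≤s) (allFin (suc n))))

    realisation : Realisation τ
    realisation = complete-state-realises (subst (State n) none-pending
      (subst (λ y → State y (length (pending τ (suc y)))) (toℕ-fromℕ n) (construct (fromℕ n))))

-- Surjectivity and the bijection.

-- `φ` and `τ` increase on the same two classes and send the deficiencies to the same values, the
-- descent bottoms, so uniqueness applies.
Φ-of-realisation : (τ : Permutation′ (suc n)) (r : Realisation τ) {φ : Permutation′ (suc n)} →
                   IsΦ (Realisation.ρ r) φ → φ ⟨$⟩ʳ zero ≡ fromℕ n → τ ⟨$⟩ʳ zero ≡ fromℕ n →
                   IncreasingOnClasses (Deficiency τ) τ → φ ≈ τ
Φ-of-realisation τ r {φ} isΦ φ0 τ0 inc = increasing-on-classes-unique φ τ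
  (λ a≢0 a⇒b b⇒a → increasing-on-tops ρ φ last avoids isΦ φ0 a≢0
    (from tops ∘ a⇒b ∘ to tops) (from tops ∘ b⇒a ∘ to tops))
  inc (trans φ0 (sym τ0)) same
  where
  open Realisation r
  open EndsInZero.Image ρ last isΦ
  open Equivalence
  same : ∀ {a b} → φ ⟨$⟩ʳ a ≡ τ ⟨$⟩ʳ b → (Deficiency τ a → Deficiency τ b) × (Deficiency τ b → Deficiency τ a)
  same {a} {b} eq =
      (λ def → subst (τ ⟨$⟩ʳ b <_) (inverseˡ τ) (to bottoms (subst (DescentBottom ρ) eq (image-top (from tops def)))))
    , (λ def → to tops (image-bottom (subst (DescentBottom ρ) (sym eq)
        (from bottoms (subst (τ ⟨$⟩ʳ b <_) (sym (inverseˡ τ)) def)))))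

module _ (π : Permutation′ n) (avoids : π Avoids [321]) (σ : Permutation′ n)
         (r : Realisation (crown π)) (hat≈ : hat σ ≈ Realisation.ρ r) where

  private
    module R = Realisation r
    hat≈′ : R.ρ ≈ hat σ
    hat≈′ i = sym (hat≈ i)

  realised-avoids : σ Avoids [213]
  realised-avoids = 213-avoiding σ (hat-avoids-213⁻ σ λ {i} {j} {k} i<j j<k lt gt →
    R.avoids i<j j<k (subst₂ _<_ (hat≈ j) (hat≈ i) lt) (subst₂ _<_ (hat≈ i) (hat≈ k) gt))

  realised-Ψ : Ψ σ ≈ π
  realised-Ψ i = inject₁-injective (begin
    inject₁ (Ψ σ ⟨$⟩ʳ i)      ≡⟨ Ψ-letter σ i ⟩
    Φ (hat σ) ⟨$⟩ʳ suc i      ≡⟨ Φ-cong {ρ = hat σ} {R.ρ} hat≈ (suc i) ⟩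
    Φ R.ρ ⟨$⟩ʳ suc i          ≡⟨ Φ-of-realisation (crown π) r (Φ-isΦ R.ρ)
                                   (trans (Φ-cong {ρ = R.ρ} {hat σ} hat≈′ zero) (Φ-hat-zero σ))
                                   refl (crown-increasing π avoids) (suc i) ⟩
    crown π ⟨$⟩ʳ suc i        ≡⟨ crown-suc π i ⟩
    inject₁ (π ⟨$⟩ʳ i)        ∎)
    where open ≡-Reasoning

hat-remove : (ρ : Permutation′ (suc n)) → ρ ⟨$⟩ʳ fromℕ n ≡ zero → hat (remove (fromℕ n) ρ) ≈ ρ
hat-remove {n} ρ last = subst (λ z → insert (fromℕ n) z (remove (fromℕ n) ρ) ≈ ρ) last (insert-remove (fromℕ n) ρ)

-- Here `n ≥ 1` enters: the first letter of `crown π` is then nonzero, so the value `zero` stands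
-- later.
crown-zero-bottom : (π : Permutation′ n) → 0 ℕ.< n → zero {n} < crown π ⟨$⟩ˡ zero
crown-zero-bottom {n} π 0<n = ≤∧≢⇒< z≤n λ eq → ℕ.<⇒≢ 0<n
  (trans (cong toℕ (trans (sym (inverseʳ (crown π))) (cong (crown π ⟨$⟩ʳ_) (sym eq)))) (toℕ-fromℕ n))

Ψ-surjective : (π : Permutation′ n) → 0 ℕ.< n → π Avoids [321] →
               ∃[ σ ] σ Avoids [213] × Ψ σ ≈ π
Ψ-surjective {n} π 0<n avoids = go (SlotsOf.realisation (crown π) (crown-zero-bottom π 0<n) (crown-crosses π))
  where
  go : Realisation (crown π) → ∃[ σ ] σ Avoids [213] × Ψ σ ≈ π
  go r = σ , realised-avoids π avoids σ r hat≈ , realised-Ψ π avoids σ r hat≈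
    where
    σ = remove (fromℕ n) (Realisation.ρ r)
    hat≈ = hat-remove (Realisation.ρ r) (Realisation.last r)

theorem2p12 : ∀ (n : ℕ) → n ≥ 1 →
    Σ[ Ψ-avoids ∈ (∀ (σ : Permutation′ n) → σ Avoids [213] → Ψ σ Avoids [321]) ]
    Bijective {A = 𝔖 n [213]} {B = 𝔖 n [321]} (_≈_ on proj₁) (_≈_ on proj₁)
    (λ (σ , σ-avoids) → Ψ σ , Ψ-avoids σ σ-avoids)
theorem2p12 n n≥1 = Ψ-avoids-321
  , (λ {(σ , avoids)} {(σ′ , avoids′)} → Ψ-injective σ σ′ avoids avoids′)
  , λ (π , avoids) →
      let σ , σ-avoids , Ψσ≈π = Ψ-surjective π n≥1 avoids
      -- Surjectivity up to `_≈_` concerns every representative of `σ`, hence `Ψ-cong`.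
      in (σ , σ-avoids) , λ {(σ′ , _)} σ′≈σ i → trans (Ψ-cong {σ = σ′} {σ} σ′≈σ i) (Ψσ≈π i)
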